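{- For each integer $n \geq 6$, $\mathrm{cms}(n,2)=\lfloor n/3\rfloor$, and for each even integer $n \geq 4$, $\mathrm{cms}_1(n,2)=\frac{n-2}{2}$.
   Context: All graphs are finite and simple. For a graph $G$ with $m$ edges, an ordering of $G$ is a bijection $\ell: E(G)\to\mathbb{Z}_m$. For distinct edges $e,e'$, the forward distance $d_\ell(e,e')$ is the smallest positive integer $d$ with $\ell(e)+d=\ell(e')$ in $\mathbb{Z}_m$, and $d_\ell\{e,e'\}=\min\{d_\ell(e,e'),d_\ell(e',e)\}$. Two edges are adjacent if they share a vertex. $\mathrm{cms}(\ell)$ is the largest $s\in\{1,\dots,m\}$ such that $d_\ell\{e,e'\}\geq s$ for every pair of adjacent edges; $\mathrm{cms}(G)$ is the maximum of $\mathrm{cms}(\ell)$ over all orderings of $G$. A $k$-regular graph is class 1 if its edges can be properly coloured with $k$ colours. $\mathrm{cms}(n,k)$ is the minimum of $\mathrm{cms}(G)$ over all $k$-regular graphs on $n$ vertices, and $\mathrm{cms}_1(n,k)$ is the minimum of $\mathrm{cms}(G)$ over all $k$-regular class 1 graphs on $n$ vertices. -}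

module Defs where

open import Data.Nat using (ℕ; zero; suc; _+_; _∸_; _≤_; _<_; _<ᵇ_)
open import Data.Nat as ℕ using ()
open import Data.Bool using (Bool; true; false; if_then_else_)
open import Data.Fin as Fin using (Fin; toℕ)
open import Data.List using (List; map; allFin)
open import Data.Nat.ListAction using (sum)
open import Data.Product using (Σ; _×_; _,_; proj₁; proj₂; ∃)
open import Data.Sum using (_⊎_)
open import Relation.Binary.PropositionalEquality using (_≡_; _≢_)
open import Function.Bundles using (_⤖_; Bijection)

record Graph (n : ℕ) : Set where
  field
    adj    : Fin n → Fin n → Bool
    sym    : ∀ u v → adj u v ≡ adj v u
    irrefl : ∀ u → adj u u ≡ false

open Graph public

-- Edges: unordered pairs {u,v}, represented uniquely by u < v.
Edge : ∀ {n} → Graph n → Set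
Edge {n} G = Σ (Fin n × Fin n) λ p → (proj₁ p Fin.< proj₂ p) × (adj G (proj₁ p) (proj₂ p) ≡ true)

Adjacent : ∀ {n} {G : Graph n} → Edge G → Edge G → Set
Adjacent ((u , v) , _) ((u' , v') , _) =
  ((u , v) ≢ (u' , v')) × (u ≡ u' ⊎ u ≡ v' ⊎ v ≡ u' ⊎ v ≡ v')

degree : ∀ {n} → Graph n → Fin n → ℕ
degree {n} G u = sum (map (λ v → if adj G u v then 1 else 0) (allFin n))

Regular : ∀ {n} → ℕ → Graph n → Set
Regular {n} k G = ∀ (u : Fin n) → degree G u ≡ k

Class1 : ∀ {n} → ℕ → Graph n → Set
Class1 k G = Σ (Edge G → Fin k) λ c → ∀ e e' → Adjacent {G = G} e e' → c e ≢ c e'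

-- An ordering of G with m edges: a bijection E(G) → ℤ_m (= Fin m).
-- (Such a bijection exists only when m = |E(G)|.)
Ordering : ∀ {n} → Graph n → ℕ → Set
Ordering G m = Edge G ⤖ Fin m

-- forward distance in ℤ_m from a to b (for a ≠ b): least d > 0 with a + d = b.
fwd : ∀ {m} → Fin m → Fin m → ℕ
fwd {m} a b = if toℕ a <ᵇ toℕ b then toℕ b ∸ toℕ a else (m + toℕ b) ∸ toℕ a

dist : ∀ {m} → Fin m → Fin m → ℕ
dist a b = ℕ._⊓_ (fwd a b) (fwd b a)

Spread : ∀ {n m} {G : Graph n} → Ordering G m → ℕ → Set
Spread {G = G} ℓ s = ∀ e e' → Adjacent {G = G} e e' →
  s ≤ dist (Bijection.to ℓ e) (Bijection.to ℓ e')

IsCmsOrd : ∀ {n m} {G : Graph n} → Ordering G m → ℕ → Set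
IsCmsOrd {m = m} {G} ℓ s = (1 ≤ s) × (s ≤ m) × Spread {G = G} ℓ s ×
  (∀ t → 1 ≤ t → t ≤ m → Spread {G = G} ℓ t → t ≤ s)

IsCmsGraph : ∀ {n} → Graph n → ℕ → Set
IsCmsGraph G s =
  (∃ λ m → Σ (Ordering G m) λ ℓ → IsCmsOrd {G = G} ℓ s) ×
  (∀ m (ℓ : Ordering G m) t → IsCmsOrd {G = G} ℓ t → t ≤ s)

IsMinCms : (∀ {n} → Graph n → Set) → ℕ → ℕ → Set
IsMinCms P n s =
  (Σ (Graph n) λ G → P G × IsCmsGraph G s) ×
  (∀ (G : Graph n) t → P G → IsCmsGraph G t → s ≤ t)

IsCms : ℕ → ℕ → ℕ → Set
IsCms n k s = IsMinCms (Regular k) n s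

IsCms₁ : ℕ → ℕ → ℕ → Set
IsCms₁ n k s = IsMinCms (λ G → Regular k G × Class1 k G) n s

{-# OPTIONS --safe #-}
module Submission where

-- A 2-regular graph is a disjoint union of cycles. Orient them, and let each edge be represented
-- by its tail: then an ordering of spread s is an arrangement of the vertices around a circle in
-- which each vertex is at distance at least s from its successor.
--
-- For cms(n,2) the circle is cut into three columns of about n/3 positions, the height of a
-- position in its column being its level. Elements of different columns may be consecutive
-- provided their levels compare in the right direction, and then three more vertices can always
-- be inserted between them at the cost of one new level on top. This reduces all cycles to lengths
-- 3, 4 and 5, and explicit patterns place the groups 3, 4+5, 4+4+4, 5+5+5 and the possible
-- remainders 4, 4+4, 5, 5+5. A triangle shows that n/3 cannot be exceeded.
--
-- If all cycles are even, two columns suffice: each cycle is folded into a ladder, whose consecutive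
-- elements lie in different columns on levels that differ by at most one. No ordering does better,
-- since an edge would have two antipodal edges.

open import Defs
open import Axiom.UniquenessOfIdentityProofs using (module Decidable⇒UIP)
open import Data.Bool using (Bool; true; false; if_then_else_; T; _∨_)
import Data.Bool.Properties as Boolₚ
open import Data.Empty using (⊥; ⊥-elim)
open import Data.Fin as Fin using (Fin; zero; suc; toℕ; fromℕ; inject₁)
import Data.Fin.Properties as Finₚ
open import Data.Fin.Relation.Unary.Top using (view; view-fromℕ; view-inject₁; ‵fromℕ; ‵inj₁)
open import Data.List using (List; []; _∷_; _++_; _∷ʳ_; length; map; concat; concatMap; lookup; allFin; initLast; _∷ʳ′_)
import Data.List.Properties as Listₚ
import Data.List.Membership.DecPropositional as DecMembership
open import Data.List.Membership.Propositional using (_∈_; _∉_)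
open import Data.List.Membership.Propositional.Properties
open import Data.List.Relation.Unary.All as All using (All; []; _∷_)
import Data.List.Relation.Unary.All.Properties as Allₚ
open import Data.List.Relation.Unary.AllPairs using ([]; _∷_)
open import Data.List.Relation.Unary.Any as Any using (here; there)
import Data.List.Relation.Unary.Any.Properties as Anyₚ
open import Data.List.Relation.Unary.Unique.Propositional using (Unique)
open import Data.List.Relation.Unary.Unique.Propositional.Properties as Uniqueₚ using (Unique[x∷xs]⇒x∉xs)
open import Data.Maybe using (Maybe; just; nothing)
open import Data.Nat using (ℕ; zero; suc; _+_; _∸_; _*_; _/_; _≤ᵇ_; _<ᵇ_; _≤_; _<_; z≤n; s≤s; s≤s⁻¹)
open import Data.Nat.Divisibility using (_∣_; divides; ∣m∣n⇒∣m+n; ∣-refl; _∣0)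
import Data.Nat.DivMod as DivMod
open import Data.Nat.ListAction using (sum)
import Data.Nat.Properties as ℕₚ
open import Data.Nat.Tactic.RingSolver using (solve-∀)
open import Data.Product using (Σ; ∃; ∃₂; _×_; _,_; proj₁; proj₂; uncurry)
open import Data.Sum as Sum using (_⊎_; inj₁; inj₂)
open import Function using (_∘_)
open import Function.Bundles using (Bijection; mk⤖)
open import Function.Consequences.Propositional using (strictlySurjective⇒surjective)
open import Function.Definitions using (Injective)
open import Relation.Binary.Definitions using (tri<; tri≈; tri>)
open import Relation.Binary.PropositionalEquality renaming (sym to ≡-sym)
open import Relation.Nullary using (¬_; yes; no; contradiction)
open import Relation.Nullary.Decidable using (⌊_⌋; ¬?; decidable-stable)

-- Cyclic lists and spacing around a circle

module _ {V : Set} where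

  links : List V → List (V × V)
  links (x ∷ y ∷ xs) = (x , y) ∷ links (y ∷ xs)
  links _            = []

  -- Repeating the head at the end turns the closing arc into an ordinary link, so that facts about
  -- `links` carry over to cycles.
  arcs : List V → List (V × V)
  arcs []       = []
  arcs (x ∷ xs) = links (x ∷ xs ∷ʳ x)

  nth : List V → ℕ → Maybe V
  nth []       _       = nothing
  nth (x ∷ xs) zero    = just x
  nth (x ∷ xs) (suc i) = nth xs i

  nth-++ˡ : ∀ xs ys {i x} → nth xs i ≡ just x → nth (xs ++ ys) i ≡ just x
  nth-++ˡ (_ ∷ xs) ys {zero}  eq = eq
  nth-++ˡ (_ ∷ xs) ys {suc i} eq = nth-++ˡ xs ys eq

  nth-++ʳ : ∀ xs ys {i} → nth (xs ++ ys) (length xs + i) ≡ nth ys i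
  nth-++ʳ []       ys = refl
  nth-++ʳ (_ ∷ xs) ys = nth-++ʳ xs ys

  nth-length : ∀ xs {i x} → nth xs i ≡ just x → i < length xs
  nth-length (_ ∷ xs) {zero}  eq = s≤s z≤n
  nth-length (_ ∷ xs) {suc i} eq = s≤s (nth-length xs eq)

  -- far and back say j − i ≥ s and length xs − (j − i) ≥ s: on the circle of the positions of xs,
  -- x and y are at distance at least s.
  record Ahead (s : ℕ) (xs : List V) (x y : V) : Set where
    constructor ahead
    field
      i j  : ℕ
      atˣ  : nth xs i ≡ just x
      atʸ  : nth xs j ≡ just y
      far  : s + i ≤ j
      back : j + s ≤ length xs + i

  Spaced : ℕ → List V → V → V → Set
  Spaced s xs x y = Ahead s xs x y ⊎ Ahead s xs y x

-- Three columns

data Col : Set where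
  A B C : Col

next : Col → Col
next A = B
next B = C
next C = A

module _ {V : Set} where

  Levels : Set
  Levels = Col → List V

  cols : List V → List V → List V → Levels
  cols as bs cs A = as
  cols as bs cs B = bs
  cols as bs cs C = cs

  infixr 5 _▸_
  _▸_ : V × V × V → Levels → Levels
  ((a , b , c) ▸ L) A = a ∷ L A
  ((a , b , c) ▸ L) B = b ∷ L B
  ((a , b , c) ▸ L) C = c ∷ L C

  -- Depths are counted from the most recently added level, so that adding a level
  -- shifts all of them alike.
  record Up (ε : Col → ℕ) (L : Levels) (x y : V) : Set where
    constructor up
    field
      k   : Col
      d e : ℕ
      atˣ : nth (L k) d ≡ just x
      atʸ : nth (L (next k)) e ≡ just y
      e≤  : e ≤ ε k + d

  Joined : (Col → ℕ) → Levels → V → V → Set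
  Joined ε L x y = Up ε L x y ⊎ Up ε L y x

  Fits : (Col → ℕ) → Levels → List V → Set
  Fits ε L c = All (uncurry (Joined ε L)) (arcs c)

  -- Only full triples are added, always on top, so the excess that a column has at its bottom never
  -- changes.
  data Ext : ℕ → Levels → Levels → Set where
    base : ∀ {L} → Ext 0 L L
    add  : ∀ {m L L′} t → Ext m L L′ → Ext (suc m) L (t ▸ L′)

  Ext-trans : ∀ {m m′ L L′ L″} → Ext m L′ L″ → Ext m′ L L′ → Ext (m + m′) L L″
  Ext-trans base      q = q
  Ext-trans (add t p) q = add t (Ext-trans p q)

  length-▸ : ∀ t L k → length ((t ▸ L) k) ≡ suc (length (L k))
  length-▸ t L A = refl
  length-▸ t L B = refl
  length-▸ t L C = refl

  Ext-length : ∀ {m L L′} → Ext m L L′ → ∀ k → length (L′ k) ≡ m + length (L k)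
  Ext-length base k = refl
  Ext-length {L′ = L′} (add {L′ = L″} t p) k = trans (length-▸ t L″ k) (cong suc (Ext-length p k))

  nth-▸ : ∀ {t L x d} k → nth (L k) d ≡ just x → nth ((t ▸ L) k) (suc d) ≡ just x
  nth-▸ A eq = eq
  nth-▸ B eq = eq
  nth-▸ C eq = eq

  Up-▸ : ∀ {ε t L x y} → Up ε L x y → Up ε (t ▸ L) x y
  Up-▸ {ε} {t} {L} (up k d e p q e≤) =
    up k (suc d) (suc e) (nth-▸ {t} {L} k p) (nth-▸ {t} {L} (next k) q)
       (subst (suc e ≤_) (≡-sym (ℕₚ.+-suc (ε k) d)) (s≤s e≤))

  Fits-Ext : ∀ {ε m L L′} c → Ext m L L′ → Fits ε L c → Fits ε L′ c
  Fits-Ext c base      f = f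
  Fits-Ext {ε} c (add {L′ = L′} t p) f =
    All.map (Sum.map (Up-▸ {ε} {t} {L′}) (Up-▸ {ε} {t} {L′})) (Fits-Ext c p f)

  -- With e ∸ d on the left the side condition computes for literals e ≤ d even if ε is a variable.
  fw : ∀ {ε L x y} k d e → nth (L k) d ≡ just x → nth (L (next k)) e ≡ just y →
       {le : T ((e ∸ d) ≤ᵇ ε k)} → Joined ε L x y
  fw {ε} k d e p q {le} = inj₁ (up k d e p q (begin
    e           ≤⟨ ℕₚ.m≤n+m∸n e d ⟩
    d + (e ∸ d) ≤⟨ ℕₚ.+-monoʳ-≤ d (ℕₚ.≤ᵇ⇒≤ (e ∸ d) (ε k) le) ⟩
    d + ε k     ≡⟨ ℕₚ.+-comm d (ε k) ⟩
    ε k + d     ∎))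
    where open ℕₚ.≤-Reasoning

  bw : ∀ {ε L x y} k d e → nth (L k) d ≡ just y → nth (L (next k)) e ≡ just x →
       {le : T ((e ∸ d) ≤ᵇ ε k)} → Joined ε L x y
  bw {ε} {L} k d e p q {le} = Sum.swap (fw {ε} {L} k d e p q {le})

  -- If x is in column k and y in column next k, the new top elements of columns next k, k and
  -- next (next k), in this order, form a path that joins x to y.
  insertUp : ∀ {ε L x y} p q r → Up ε L x y → ∃ λ t →
    Joined ε (t ▸ L) x p × Joined ε (t ▸ L) p q × Joined ε (t ▸ L) q r × Joined ε (t ▸ L) r y
  insertUp p q r (up A d e atˣ atʸ _) = (q , p , r) ,
    fw A (suc d) 0 atˣ refl , bw A 0 0 refl refl , bw C 0 0 refl refl , bw B (suc e) 0 atʸ refl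
  insertUp p q r (up B d e atˣ atʸ _) = (r , q , p) ,
    fw B (suc d) 0 atˣ refl , bw B 0 0 refl refl , bw A 0 0 refl refl , bw C (suc e) 0 atʸ refl
  insertUp p q r (up C d e atˣ atʸ _) = (p , r , q) ,
    fw C (suc d) 0 atˣ refl , bw C 0 0 refl refl , bw B 0 0 refl refl , bw A (suc e) 0 atʸ refl

  insert : ∀ {ε L x y} p q r → Joined ε L x y → ∃ λ t →
    Joined ε (t ▸ L) x p × Joined ε (t ▸ L) p q × Joined ε (t ▸ L) q r × Joined ε (t ▸ L) r y
  insert p q r (inj₁ u) = insertUp p q r u
  insert {ε} {L} p q r (inj₂ u) with insertUp {ε} {L} r q p u
  ... | t , yr , rq , qp , px = t , Sum.swap px , Sum.swap qp , Sum.swap rq , Sum.swap yr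

  grow : ∀ {ε L} h p q r y t → Fits ε L (h ∷ y ∷ t) →
    ∃ λ l → Fits ε (l ▸ L) (h ∷ p ∷ q ∷ r ∷ y ∷ t)
  grow {ε} {L} h p q r y t (hy ∷ f) with insert {ε} {L} p q r hy
  ... | l , hp , pq , qr , ry = l , hp ∷ pq ∷ qr ∷ ry ∷
    All.map (Sum.map (Up-▸ {ε} {l} {L}) (Up-▸ {ε} {l} {L})) f

  data Short : List V → Set where
    three : ∀ {a b c}     → Short (a ∷ b ∷ c ∷ [])
    four  : ∀ {a b c d}   → Short (a ∷ b ∷ c ∷ d ∷ [])
    five  : ∀ {a b c d e} → Short (a ∷ b ∷ c ∷ d ∷ e ∷ [])

  -- The cycle `c₀` is what is left of `c` after the removal of triples of vertices. Quantifying
  -- over `ε` and `L` allows the bottom of the columns, and with it the slack, to be chosen later.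
  record Core (c : List V) : Set where
    constructor core
    field
      {c₀}   : List V
      short  : Short c₀
      m      : ℕ
      size   : length c ≡ 3 * m + length c₀
      extend : ∀ {ε} L → Fits ε L c₀ → ∃ λ L′ → Ext m L L′ × Fits ε L′ c

  -- Triples behind the head are removed until 3, 4 or 5 vertices are left. On the way back each
  -- triple is inserted into the arc from the head to its successor, which costs one level.
  coreOf : ∀ h t → 2 ≤ length t → Core (h ∷ t)
  coreOf h (a ∷ [])             (s≤s ())
  coreOf h (a ∷ b ∷ [])         _ = core three 0 refl λ L f → L , base , f
  coreOf h (a ∷ b ∷ c ∷ [])     _ = core four 0 refl λ L f → L , base , f
  coreOf h (a ∷ b ∷ c ∷ d ∷ []) _ = core five 0 refl λ L f → L , base , f
  coreOf h (p ∷ q ∷ r ∷ y ∷ z ∷ t) _ with coreOf h (y ∷ z ∷ t) (s≤s (s≤s z≤n))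
  ... | core {c₀} short m size extend = core short (suc m)
        (trans (cong (3 +_) size) (lemma m (length c₀))) λ {ε} L f →
          let L′ , E , f′ = extend L f
              l , f″ = grow {ε} {L′} h p q r y (z ∷ t) f′
          in l ▸ L′ , add l E , f″
    where
    lemma : ∀ m l → 3 + (3 * m + l) ≡ 3 * suc m + l
    lemma = solve-∀

  total : List (List V) → ℕ
  total cs = sum (map length cs)

  -- The short cycles that still wait for partners. Each of the groups 4+5, 4+4+4 and 5+5+5 has a
  -- size divisible by 3 and is placed as soon as it is complete, so at most two cycles wait, and
  -- two waiting cycles have the same length.
  data Pending : List (List V) → Set where
    none : Pending []
    p4   : ∀ {a b c d} → Pending ((a ∷ b ∷ c ∷ d ∷ []) ∷ [])
    p44  : ∀ {a b c d a′ b′ c′ d′} → Pending ((a ∷ b ∷ c ∷ d ∷ []) ∷ (a′ ∷ b′ ∷ c′ ∷ d′ ∷ []) ∷ [])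
    p5   : ∀ {a b c d e} → Pending ((a ∷ b ∷ c ∷ d ∷ e ∷ []) ∷ [])
    p55  : ∀ {a b c d e a′ b′ c′ d′ e′} →
      Pending ((a ∷ b ∷ c ∷ d ∷ e ∷ []) ∷ (a′ ∷ b′ ∷ c′ ∷ d′ ∷ e′ ∷ []) ∷ [])

  -- The following patterns were found by a computer search.
  place45 : ∀ {ε} L {a b c d e f g h i} → ∃ λ L′ → Ext 3 L L′ ×
    Fits ε L′ (a ∷ b ∷ c ∷ d ∷ []) × Fits ε L′ (e ∷ f ∷ g ∷ h ∷ i ∷ [])
  place45 L {a} {b} {c} {d} {e} {f} {g} {h} {i} = (a , b , g) ▸ (c , f , d) ▸ (e , h , i) ▸ L ,
    add _ (add _ (add _ base)) ,
    (fw A 0 0 refl refl ∷ bw A 1 0 refl refl ∷ bw C 1 1 refl refl ∷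
     fw C 1 0 refl refl ∷ []) ,
    (fw A 2 1 refl refl ∷ fw B 1 0 refl refl ∷ bw B 2 0 refl refl ∷
     fw B 2 2 refl refl ∷ fw C 2 2 refl refl ∷ [])

  place444 : ∀ {ε} L {a b c d e f g h i j k l} → ∃ λ L′ → Ext 4 L L′ ×
    Fits ε L′ (a ∷ b ∷ c ∷ d ∷ []) × Fits ε L′ (e ∷ f ∷ g ∷ h ∷ []) × Fits ε L′ (i ∷ j ∷ k ∷ l ∷ [])
  place444 L {a} {b} {c} {d} {e} {f} {g} {h} {i} {j} {k} {l} = (a , b , j) ▸ (c , f , d) ▸ (e , i , l) ▸ (g , k , h) ▸ L ,
    add _ (add _ (add _ (add _ base))) ,
    (fw A 0 0 refl refl ∷ bw A 1 0 refl refl ∷ bw C 1 1 refl refl ∷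
     fw C 1 0 refl refl ∷ []) ,
    (fw A 2 1 refl refl ∷ bw A 3 1 refl refl ∷ bw C 3 3 refl refl ∷
     fw C 3 2 refl refl ∷ []) ,
    (fw B 2 0 refl refl ∷ bw B 3 0 refl refl ∷ fw B 3 2 refl refl ∷
     bw B 2 2 refl refl ∷ [])

  place555 : ∀ {ε} L {a b c d e f g h i j k l m n o} → ∃ λ L′ → Ext 5 L L′ ×
    Fits ε L′ (a ∷ b ∷ c ∷ d ∷ e ∷ []) × Fits ε L′ (f ∷ g ∷ h ∷ i ∷ j ∷ []) × Fits ε L′ (k ∷ l ∷ m ∷ n ∷ o ∷ [])
  place555 L {a} {b} {c} {d} {e} {f} {g} {h} {i} {j} {k} {l} {m} {n} {o} = (a , b , e) ▸ (c , d , h) ▸ (f , g , j) ▸ (k , i , l) ▸ (n , m , o) ▸ L ,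
    add _ (add _ (add _ (add _ (add _ base)))) ,
    (fw A 0 0 refl refl ∷ bw A 1 0 refl refl ∷ fw A 1 1 refl refl ∷
     fw B 1 0 refl refl ∷ fw C 0 0 refl refl ∷ []) ,
    (fw A 2 2 refl refl ∷ fw B 2 1 refl refl ∷ bw B 3 1 refl refl ∷
     fw B 3 2 refl refl ∷ fw C 2 2 refl refl ∷ []) ,
    (bw C 3 3 refl refl ∷ bw B 4 3 refl refl ∷ bw A 4 4 refl refl ∷
     bw C 4 4 refl refl ∷ fw C 4 3 refl refl ∷ [])

  slack : ℕ → ℕ → Col → ℕ
  slack α β A = β
  slack α β B = 0
  slack α β C = α

  -- Waiting cycles that never find partners form the bottom of the columns, where their uneven ends
  -- do no harm: depths are counted from the top, and everything above consists of full levels. The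
  -- column lengths split the sizes as 4 = 2+1+1, 10 = 4+3+3, 5 = 2+2+1 and 8 = 3+3+2.
  bottom4 : ∀ {a b c d} → All (Fits (slack 1 0) (cols (a ∷ c ∷ []) (b ∷ []) (d ∷ [])))
    ((a ∷ b ∷ c ∷ d ∷ []) ∷ [])
  bottom4 =
    (fw A 0 0 refl refl ∷ bw A 1 0 refl refl ∷ bw C 0 1 refl refl ∷
     fw C 0 0 refl refl ∷ []) ∷ []

  bottom55 : ∀ {a b c d e f g h i j} → All (Fits (slack 1 0) (cols (a ∷ c ∷ f ∷ i ∷ []) (b ∷ d ∷ h ∷ []) (e ∷ g ∷ j ∷ [])))
    ((a ∷ b ∷ c ∷ d ∷ e ∷ []) ∷ (f ∷ g ∷ h ∷ i ∷ j ∷ []) ∷ [])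
  bottom55 =
    (fw A 0 0 refl refl ∷ bw A 1 0 refl refl ∷ fw A 1 1 refl refl ∷
     fw B 1 0 refl refl ∷ fw C 0 0 refl refl ∷ []) ∷
    (bw C 1 2 refl refl ∷ bw B 2 1 refl refl ∷ bw A 3 2 refl refl ∷
     bw C 2 3 refl refl ∷ fw C 2 2 refl refl ∷ []) ∷ []

  bottom5 : ∀ {a b c d e} → All (Fits (slack 1 1) (cols (a ∷ c ∷ []) (b ∷ d ∷ []) (e ∷ [])))
    ((a ∷ b ∷ c ∷ d ∷ e ∷ []) ∷ [])
  bottom5 =
    (fw A 0 0 refl refl ∷ bw A 1 0 refl refl ∷ fw A 1 1 refl refl ∷
     fw B 1 0 refl refl ∷ fw C 0 0 refl refl ∷ []) ∷ []

  bottom44 : ∀ {a b c d e f g h} → All (Fits (slack 1 1) (cols (a ∷ c ∷ e ∷ []) (b ∷ f ∷ h ∷ []) (d ∷ g ∷ [])))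
    ((a ∷ b ∷ c ∷ d ∷ []) ∷ (e ∷ f ∷ g ∷ h ∷ []) ∷ [])
  bottom44 =
    (fw A 0 0 refl refl ∷ bw A 1 0 refl refl ∷ bw C 0 1 refl refl ∷
     fw C 0 0 refl refl ∷ []) ∷
    (fw A 2 1 refl refl ∷ fw B 1 1 refl refl ∷ bw B 2 1 refl refl ∷
     bw A 2 2 refl refl ∷ []) ∷ []

  Fits-Exts : ∀ {ε m L L′ cs} → Ext m L L′ → All (Fits ε L) cs → All (Fits ε L′) cs
  Fits-Exts E = All.map λ {c} → Fits-Ext c E

  -- Which cycles are left over is known only after all of them have been read, yet these go to the
  -- bottom. Hence `place` is a function: from any levels that hold the cycles still waiting
  -- afterwards, it builds levels that also hold the new cycle and those waiting before.
  record Step (c₀ : List V) (P : List (List V)) : Set where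
    constructor step
    field
      {P′}    : List (List V)
      pending : Pending P′
      m       : ℕ
      size    : length c₀ + total P ≡ 3 * m + total P′
      place   : ∀ {ε} L → All (Fits ε L) P′ →
                ∃ λ L′ → Ext m L L′ × Fits ε L′ c₀ × All (Fits ε L′) P

  postpone : ∀ {c₀ P} → Pending (c₀ ∷ P) → Step c₀ P
  postpone p = step p 0 refl λ { L (f ∷ fs) → L , base , f , fs }

  stepOf : ∀ {c₀ P} → Short c₀ → Pending P → Step c₀ P
  stepOf (three {a} {b} {c}) p = step p 1 refl λ L fs →
    (a , b , c) ▸ L , add _ base ,
    (fw A 0 0 refl refl ∷ fw B 0 0 refl refl ∷ fw C 0 0 refl refl ∷ []) ,
    Fits-Exts (add _ base) fs
  stepOf four none = postpone p4
  stepOf four p4   = postpone p44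
  stepOf five none = postpone p5
  stepOf five p5   = postpone p55
  stepOf four p44 = step none 4 refl λ L _ →
    let L′ , E , f , g , h = place444 L in L′ , E , f , g ∷ h ∷ []
  stepOf four p5 = step none 3 refl λ L _ →
    let L′ , E , f , g = place45 L in L′ , E , f , g ∷ []
  stepOf four p55 = step p5 3 refl λ L fs →
    let L′ , E , f , g = place45 L in L′ , E , f , g ∷ Fits-Exts E fs
  stepOf five p4 = step none 3 refl λ L _ →
    let L′ , E , f , g = place45 L in L′ , E , g , f ∷ []
  stepOf five p44 = step p4 3 refl λ L fs →
    let L′ , E , f , g = place45 L in L′ , E , g , f ∷ Fits-Exts E fs
  stepOf five p55 = step none 5 refl λ L _ →
    let L′ , E , f , g , h = place555 L in L′ , E , f , g ∷ h ∷ []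

  record Plan (cs : List (List V)) : Set where
    constructor plan
    field
      {P}     : List (List V)
      pending : Pending P
      m       : ℕ
      size    : total cs ≡ 3 * m + total P
      place   : ∀ {ε} L → All (Fits ε L) P → ∃ λ L′ → Ext m L L′ × All (Fits ε L′) cs

  planOf : ∀ {cs} → All (λ c → 3 ≤ length c) cs → Plan cs
  planOf [] = plan none 0 refl λ L _ → L , base , []
  planOf {(h ∷ t) ∷ cs} (s≤s 2≤t ∷ ls)
    with plan {P} p m₁ eq₁ place₁ ← planOf ls
       | core {c₀} short m₂ eq₂ extend ← coreOf h t 2≤t
    with step {P′} p′ m₃ eq₃ place₃ ← stepOf short p =
    plan p′ (m₂ + (m₁ + m₃)) size λ L fs →
      -- From the bottom up: the group completed by this step, if any, then the remaining cycles of
      -- `cs`, and last the triples removed from `h ∷ t`.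
      let L₃ , E₃ , f₃ , fs₃ = place₃ L fs
          L₁ , E₁ , fs₁      = place₁ L₃ fs₃
          L₂ , E₂ , f₂       = extend L₁ (Fits-Ext c₀ E₁ f₃)
      in L₂ , Ext-trans E₂ (Ext-trans E₁ E₃) , f₂ ∷ Fits-Exts E₂ fs₁
    where
    open ≡-Reasoning
    size : length (h ∷ t) + total cs ≡ 3 * (m₂ + (m₁ + m₃)) + total P′
    size = begin
      length (h ∷ t) + total cs                       ≡⟨ cong₂ _+_ eq₂ eq₁ ⟩
      3 * m₂ + length c₀ + (3 * m₁ + total P)         ≡⟨ shuffle m₂ m₁ (length c₀) (total P) ⟩
      3 * (m₂ + m₁) + (length c₀ + total P)           ≡⟨ cong (3 * (m₂ + m₁) +_) eq₃ ⟩
      3 * (m₂ + m₁) + (3 * m₃ + total P′)             ≡⟨ collect m₂ m₁ m₃ (total P′) ⟩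
      3 * (m₂ + (m₁ + m₃)) + total P′                 ∎
      where
      shuffle : ∀ a b k l → 3 * a + k + (3 * b + l) ≡ 3 * (a + b) + (k + l)
      shuffle = solve-∀
      collect : ∀ a b c k → 3 * (a + b) + (3 * c + k) ≡ 3 * (a + (b + c)) + k
      collect = solve-∀

  -- In the circular order A, C, B the column `next k` comes just before column `k`. The way from
  -- depth `e` in `next k` forward to depth `d` in `k` is therefore the length of `next k`, plus
  -- `d`, minus `e`.
  row : Levels → List V
  row L = L A ++ L C ++ L B

  -- Columns A and B may exceed column C; the slack of a column is the excess of the next one,
  -- which is what the distances around the circle A, C, B allow.
  Up⇒Spaced : ∀ {α β s L x y} → length (L A) ≡ s + α → length (L B) ≡ s + β → length (L C) ≡ s →
    Up (slack α β) L x y → Spaced s (row L) x y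
  Up⇒Spaced {α} {β} {s} {L} ∣A∣ ∣B∣ ∣C∣ (up A d e atˣ atʸ e≤) = inj₁ (ahead d (length (L A) + (length (L C) + e))
    (nth-++ˡ (L A) _ atˣ) (trans (nth-++ʳ (L A) _) (trans (nth-++ʳ (L C) (L B)) atʸ)) far back)
    where
    open ℕₚ.≤-Reasoning
    -- Here the whole column C lies between the two positions, which settles the forward distance,
    -- and `e≤` settles the way back. In the other two cases the roles are exchanged: `e≤` gives
    -- `far`, and a whole column gives `back`.
    far : s + d ≤ length (L A) + (length (L C) + e)
    far = begin
      s + d                               ≡⟨ ℕₚ.+-comm s d ⟩
      d + s                               ≤⟨ ℕₚ.+-mono-≤ (ℕₚ.<⇒≤ (nth-length (L A) atˣ)) (ℕₚ.m≤m+n s e) ⟩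
      length (L A) + (s + e)              ≡⟨ cong (λ l → length (L A) + (l + e)) (≡-sym ∣C∣) ⟩
      length (L A) + (length (L C) + e)   ∎
    move : ∀ a c β d s → a + (c + (β + d)) + s ≡ a + (c + (s + β)) + d
    move = solve-∀
    back : length (L A) + (length (L C) + e) + s ≤ length (row L) + d
    back rewrite Listₚ.length-++ (L A) {L C ++ L B} | Listₚ.length-++ (L C) {L B} | ∣B∣ = begin
      length (L A) + (length (L C) + e) + s
        ≤⟨ ℕₚ.+-monoˡ-≤ s (ℕₚ.+-monoʳ-≤ (length (L A)) (ℕₚ.+-monoʳ-≤ (length (L C)) e≤)) ⟩
      length (L A) + (length (L C) + (β + d)) + s
        ≡⟨ move (length (L A)) (length (L C)) β d s ⟩
      length (L A) + (length (L C) + (s + β)) + d ∎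
  Up⇒Spaced {α} {β} {s} {L} ∣A∣ ∣B∣ ∣C∣ (up B d e atˣ atʸ e≤) = inj₂ (ahead (length (L A) + e) (length (L A) + (length (L C) + d))
    (trans (nth-++ʳ (L A) _) (nth-++ˡ (L C) _ atʸ)) (trans (nth-++ʳ (L A) _) (trans (nth-++ʳ (L C) (L B)) atˣ)) far back)
    where
    open ℕₚ.≤-Reasoning
    swap : ∀ s a e → s + (a + e) ≡ a + (s + e)
    swap = solve-∀
    far : s + (length (L A) + e) ≤ length (L A) + (length (L C) + d)
    far rewrite ∣C∣ = begin
      s + (length (L A) + e) ≡⟨ swap s (length (L A)) e ⟩
      length (L A) + (s + e) ≤⟨ ℕₚ.+-monoʳ-≤ (length (L A)) (ℕₚ.+-monoʳ-≤ s e≤) ⟩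
      length (L A) + (s + d) ∎
    s≤∣A∣ : s ≤ length (L A) + e
    s≤∣A∣ = ℕₚ.m≤n⇒m≤n+o e (subst (s ≤_) (≡-sym ∣A∣) (ℕₚ.m≤m+n s α))
    back : length (L A) + (length (L C) + d) + s ≤ length (row L) + (length (L A) + e)
    back rewrite Listₚ.length-++ (L A) {L C ++ L B} | Listₚ.length-++ (L C) {L B} =
      ℕₚ.+-mono-≤ (ℕₚ.+-monoʳ-≤ (length (L A)) (ℕₚ.+-monoʳ-≤ (length (L C))
        (ℕₚ.<⇒≤ (nth-length (L B) atˣ)))) s≤∣A∣
  Up⇒Spaced {α} {β} {s} {L} ∣A∣ ∣B∣ ∣C∣ (up C d e atˣ atʸ e≤) = inj₂ (ahead e (length (L A) + d)
    (nth-++ˡ (L A) _ atʸ) (trans (nth-++ʳ (L A) _) (nth-++ˡ (L C) _ atˣ)) far back)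
    where
    open ℕₚ.≤-Reasoning
    far : s + e ≤ length (L A) + d
    far rewrite ∣A∣ = begin
      s + e       ≤⟨ ℕₚ.+-monoʳ-≤ s e≤ ⟩
      s + (α + d) ≡⟨ ≡-sym (ℕₚ.+-assoc s α d) ⟩
      s + α + d   ∎
    back : length (L A) + d + s ≤ length (row L) + e
    back rewrite Listₚ.length-++ (L A) {L C ++ L B} | Listₚ.length-++ (L C) {L B} | ∣B∣ = begin
      length (L A) + d + s                        ≡⟨ ℕₚ.+-assoc (length (L A)) d s ⟩
      length (L A) + (d + s)
        ≤⟨ ℕₚ.+-monoʳ-≤ (length (L A)) (ℕₚ.+-mono-≤ (ℕₚ.<⇒≤ (nth-length (L C) atˣ)) (ℕₚ.m≤m+n s β)) ⟩
      length (L A) + (length (L C) + (s + β))     ≤⟨ ℕₚ.m≤m+n _ e ⟩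
      length (L A) + (length (L C) + (s + β)) + e ∎

  Arranged : ℕ → List V → List (List V) → Set
  Arranged s xs cs = All (λ c → All (uncurry (Spaced s xs)) (arcs c)) cs

  Arrangeable : List (List V) → Set
  Arrangeable cs = ∃₂ λ s xs → total cs < 3 * suc s × length xs ≡ total cs × Arranged s xs cs

  -- The shortest column has `m + q` elements, and this is the spread. The excess `α + β` is the
  -- remainder of the total modulo 3, so nothing is lost against a third of the total rounded down.
  settle : ∀ {cs P} α β q L₀ →
    length (L₀ A) ≡ q + α → length (L₀ B) ≡ q + β → length (L₀ C) ≡ q →
    total P ≡ 3 * q + (α + β) → α + β < 3 → All (Fits (slack α β) L₀) P →
    ∀ m → total cs ≡ 3 * m + total P →
    (∀ {ε} L → All (Fits ε L) P → ∃ λ L′ → Ext m L L′ × All (Fits ε L′) cs) →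
    Arrangeable cs
  settle {cs} α β q L₀ ∣A∣ ∣B∣ ∣C∣ ∣P∣ r<3 fs m size place with place L₀ fs
  ... | L , E , fits = m + q , row L , bound , len , All.map (All.map (Sum.[ spaced , Sum.swap ∘ spaced ])) fits
    where
    grown : ∀ k {l} → length (L₀ k) ≡ l → length (L k) ≡ m + l
    grown k eq = trans (Ext-length E k) (cong (m +_) eq)
    ∣LA∣ : length (L A) ≡ m + q + α
    ∣LA∣ = trans (grown A ∣A∣) (≡-sym (ℕₚ.+-assoc m q α))
    ∣LB∣ : length (L B) ≡ m + q + β
    ∣LB∣ = trans (grown B ∣B∣) (≡-sym (ℕₚ.+-assoc m q β))
    spaced : ∀ {x y} → Up (slack α β) L x y → Spaced (m + q) (row L) x y
    spaced = Up⇒Spaced ∣LA∣ ∣LB∣ (grown C ∣C∣)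
    sizes : total cs ≡ 3 * (m + q) + (α + β)
    sizes = trans size (trans (cong (3 * m +_) ∣P∣) (collect m q (α + β)))
      where
      collect : ∀ m q r → 3 * m + (3 * q + r) ≡ 3 * (m + q) + r
      collect = solve-∀
    bound : total cs < 3 * suc (m + q)
    bound = subst₂ _<_ (≡-sym sizes) (trans (ℕₚ.+-comm (3 * (m + q)) 3) (≡-sym (ℕₚ.*-suc 3 (m + q))))
      (ℕₚ.+-monoʳ-< (3 * (m + q)) r<3)
    len : length (row L) ≡ total cs
    len = begin
      length (row L)
        ≡⟨ trans (Listₚ.length-++ (L A)) (cong (length (L A) +_) (Listₚ.length-++ (L C))) ⟩
      length (L A) + (length (L C) + length (L B))
        ≡⟨ cong₂ _+_ ∣LA∣ (cong₂ _+_ (grown C ∣C∣) ∣LB∣) ⟩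
      m + q + α + (m + q + (m + q + β))
        ≡⟨ collect (m + q) α β ⟩
      3 * (m + q) + (α + β)
        ≡⟨ ≡-sym sizes ⟩
      total cs ∎
      where
      open ≡-Reasoning
      collect : ∀ s α β → s + α + (s + (s + β)) ≡ 3 * s + (α + β)
      collect = solve-∀

  arrange : ∀ {cs} → All (λ c → 3 ≤ length c) cs → Arrangeable cs
  arrange ls with planOf ls
  ... | plan none m size place = settle 0 0 0 (cols [] [] []) refl refl refl refl (s≤s z≤n) [] m size place
  ... | plan p4   m size place = settle 1 0 1 _ refl refl refl refl (s≤s (s≤s z≤n)) bottom4 m size place
  ... | plan p44  m size place = settle 1 1 2 _ refl refl refl refl (s≤s (s≤s (s≤s z≤n))) bottom44 m size place
  ... | plan p5   m size place = settle 1 1 1 _ refl refl refl refl (s≤s (s≤s (s≤s z≤n))) bottom5 m size place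
  ... | plan p55  m size place = settle 1 0 3 _ refl refl refl refl (s≤s (s≤s z≤n)) bottom55 m size place

-- Two columns

module _ {V : Set} where

  links-∷ʳ : ∀ (xs : List V) y z → links (xs ∷ʳ y ∷ʳ z) ≡ links (xs ∷ʳ y) ∷ʳ (y , z)
  links-∷ʳ []           y z = refl
  links-∷ʳ (x ∷ [])     y z = refl
  links-∷ʳ (x ∷ w ∷ xs) y z = cong ((x , w) ∷_) (links-∷ʳ (w ∷ xs) y z)

  -- A path of even length read from both ends at once: each rung pairs a vertex with its mirror
  -- image, and `wrap` puts a new outermost pair around the rest.
  data Rungs : V → V → List V → Set where
    rung : ∀ {x y} → Rungs x y (x ∷ y ∷ [])
    wrap : ∀ {x y u v p} → Rungs u v (u ∷ p ∷ʳ v) → Rungs x y (x ∷ (u ∷ p ∷ʳ v) ∷ʳ y)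

  rungs : ∀ k x p y → length p ≡ k * 2 → Rungs x y (x ∷ p ∷ʳ y)
  rungs zero    x [] y _ = rung
  rungs (suc k) x (u ∷ q) y eq with initLast q
  rungs (suc k) x (u ∷ .[]) y () | []
  rungs (suc k) x (u ∷ .(p ∷ʳ v)) y eq | p ∷ʳ′ v = wrap (rungs k u p v
    (ℕₚ.suc-injective (ℕₚ.suc-injective (trans (cong suc (≡-sym (trans (Listₚ.length-++ p) (ℕₚ.+-comm (length p) 1)))) eq))))

  Nearby : List V → List V → V → V → Set
  Nearby us vs x y = ∃₂ λ d e → nth us d ≡ just x × nth vs e ≡ just y × d ≤ suc e × e ≤ suc d

  Faced : List V → List V → V → V → Set
  Faced us vs x y = Nearby us vs x y ⊎ Nearby us vs y x

  Faced-∷ : ∀ {u v us vs x y} → Faced us vs x y → Faced (u ∷ us) (v ∷ vs) x y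
  Faced-∷ = Sum.map deepen deepen
    where
    deepen : ∀ {u v us vs x y} → Nearby us vs x y → Nearby (u ∷ us) (v ∷ vs) x y
    deepen (d , e , p , q , d≤ , e≤) = suc d , suc e , p , q , s≤s d≤ , s≤s e≤

  data Taller : ℕ → (us vs us′ vs′ : List V) → Set where
    base : ∀ {us vs} → Taller 0 us vs us vs
    add  : ∀ {k u v us vs us′ vs′} → Taller k us vs us′ vs′ → Taller (suc k) us vs (u ∷ us′) (v ∷ vs′)

  Taller-length : ∀ {k us vs us′ vs′} → Taller k us vs us′ vs′ →
    length us′ ≡ k + length us × length vs′ ≡ k + length vs
  Taller-length base    = refl , refl
  Taller-length (add t) = let p , q = Taller-length t in cong suc p , cong suc q

  Taller-Faced : ∀ {k us vs us′ vs′ x y} → Taller k us vs us′ vs′ → Faced us vs x y → Faced us′ vs′ x y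
  Taller-Faced base    f = f
  Taller-Faced (add t) f = Faced-∷ (Taller-Faced t f)

  data Top (x y : V) : (us vs : List V) → Set where
    straight : ∀ {us vs} → Top x y (x ∷ us) (y ∷ vs)
    crossed  : ∀ {us vs} → Top x y (y ∷ us) (x ∷ vs)

  Top⇒Faced : ∀ {us vs x y} → Top x y us vs → Faced us vs y x
  Top⇒Faced straight = inj₂ (0 , 0 , refl , refl , z≤n , z≤n)
  Top⇒Faced crossed  = inj₁ (0 , 0 , refl , refl , z≤n , z≤n)

  -- The innermost rung is laid first. Every further rung is laid the other way round from the one
  -- below it, so that both links between the two rungs change columns and climb one level. The
  -- record of the top rung in `Top` is what decides the next direction.
  ladder : ∀ {x y p} → Rungs x y p → ∀ us vs → ∃₂ λ us′ vs′ → ∃ λ k →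
    length p ≡ k * 2 × Taller k us vs us′ vs′ × Top x y us′ vs′ × All (uncurry (Faced us′ vs′)) (links p)
  ladder (rung {x} {y}) us vs = x ∷ us , y ∷ vs , 1 , refl , add base , straight ,
    inj₁ (0 , 0 , refl , refl , z≤n , z≤n) ∷ []
  ladder (wrap {x} {y} {u} {v} {p} r) us vs with ladder r us vs
  ... | us′ , vs′ , k , eq , t , top , fs with cross top
    where
    cross : ∀ {us vs} → Top u v us vs → ∃₂ λ a b → Top x y (a ∷ us) (b ∷ vs) ×
      Faced (a ∷ us) (b ∷ vs) x u × Faced (a ∷ us) (b ∷ vs) v y
    cross straight = y , x , crossed , inj₂ (1 , 0 , refl , refl , s≤s z≤n , z≤n) ,
      inj₂ (0 , 1 , refl , refl , z≤n , s≤s z≤n)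
    cross crossed  = x , y , straight , inj₁ (0 , 1 , refl , refl , z≤n , s≤s z≤n) ,
      inj₁ (1 , 0 , refl , refl , s≤s z≤n , z≤n)
  ... | a , b , top′ , xu , vy = a ∷ us′ , b ∷ vs′ , suc k ,
    cong suc (trans (Listₚ.length-++ (u ∷ p ∷ʳ v)) (trans (ℕₚ.+-comm _ 1) (cong suc eq))) ,
    add t , top′ ,
    xu ∷ subst (All _) (≡-sym (links-∷ʳ (u ∷ p) v y)) (Allₚ.++⁺ (All.map Faced-∷ fs) (vy ∷ []))

  climb : ∀ {c} → 3 ≤ length c → 2 ∣ length c → ∀ us vs → ∃₂ λ us′ vs′ → ∃ λ k →
    length c ≡ k * 2 × Taller k us vs us′ vs′ × All (uncurry (Faced us′ vs′)) (arcs c)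
  climb {x ∷ q} 3≤ (divides k eq) us vs with initLast q
  climb {x ∷ .[]} (s≤s ()) (divides k eq) us vs | []
  climb {x ∷ .(p ∷ʳ y)} 3≤ (divides zero ()) us vs | p ∷ʳ′ y
  climb {x ∷ .(p ∷ʳ y)} 3≤ (divides (suc k) eq) us vs | p ∷ʳ′ y
    with ladder (rungs k x p y (ℕₚ.suc-injective (ℕₚ.suc-injective
      (trans (cong suc (≡-sym (trans (Listₚ.length-++ p) (ℕₚ.+-comm (length p) 1)))) eq)))) us vs
  ... | us′ , vs′ , j , len , t , top , fs = us′ , vs′ , j , len , t ,
    subst (All _) (≡-sym (links-∷ʳ (x ∷ p) y x)) (Allₚ.++⁺ fs (Top⇒Faced top ∷ []))

  climbs : ∀ {cs} → All (λ c → 3 ≤ length c) cs → All (λ c → 2 ∣ length c) cs →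
    ∃₂ λ us vs → ∃ λ k → total cs ≡ k * 2 × length us ≡ k × length vs ≡ k ×
      All (λ c → All (uncurry (Faced us vs)) (arcs c)) cs
  climbs [] [] = [] , [] , 0 , refl , refl , refl , []
  climbs {c ∷ _} (l ∷ ls) (e ∷ es) with climbs ls es
  ... | us , vs , k , eq , ∣us∣ , ∣vs∣ , fs with climb {c} l e us vs
  ... | us′ , vs′ , j , eq′ , t , f with Taller-length t
  ... | ∣us′∣ , ∣vs′∣ = us′ , vs′ , j + k , trans (cong₂ _+_ eq′ eq) (≡-sym (ℕₚ.*-distribʳ-+ 2 j k)) ,
    trans ∣us′∣ (cong (j +_) ∣us∣) , trans ∣vs′∣ (cong (j +_) ∣vs∣) ,
    f ∷ All.map (All.map (Taller-Faced t)) fs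

  -- With `suc k` levels, equal levels of the two columns are antipodal, at distance `suc k`. A
  -- difference of one level costs 1, in one direction or the other, which leaves `k`.
  arrangeEven : ∀ {cs} → All (λ c → 3 ≤ length c) cs → All (λ c → 2 ∣ length c) cs →
    ∃₂ λ s xs → total cs ≤ suc s * 2 × length xs ≡ total cs × Arranged s xs cs
  arrangeEven ls es with climbs ls es
  ... | us , vs , zero  , eq , ∣us∣ , ∣vs∣ , fs = 0 , us ++ vs , subst (_≤ 2) (≡-sym eq) z≤n ,
    trans (Listₚ.length-++ us) (trans (cong₂ _+_ ∣us∣ ∣vs∣) (≡-sym eq)) ,
    All.map (All.map (Sum.[ ⊥-elim ∘ void , ⊥-elim ∘ void ])) fs
    where
    void : ∀ {x y} → Nearby us vs x y → ⊥
    void (d , _ , p , _) = ℕₚ.n≮0 (subst (d <_) ∣us∣ (nth-length us p))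
  ... | us , vs , suc k , eq , ∣us∣ , ∣vs∣ , fs = k , us ++ vs , ℕₚ.≤-reflexive eq , len ,
    All.map (All.map (Sum.[ spaced , Sum.swap ∘ spaced ])) fs
    where
    double : ∀ n → n + n ≡ n * 2
    double = solve-∀
    len : length (us ++ vs) ≡ _
    len = trans (Listₚ.length-++ us) (trans (cong₂ _+_ ∣us∣ ∣vs∣) (trans (double (suc k)) (≡-sym eq)))
    spaced : ∀ {x y} → Nearby us vs x y → Spaced k (us ++ vs) x y
    spaced (d , e , p , q , d≤ , e≤) = inj₁ (ahead d (length us + e) (nth-++ˡ us vs p) (trans (nth-++ʳ us vs) q)
      far back)
      where
      open ℕₚ.≤-Reasoning
      far : k + d ≤ length us + e
      far rewrite ∣us∣ = subst (k + d ≤_) (ℕₚ.+-suc k e) (ℕₚ.+-monoʳ-≤ k d≤)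
      back : length us + e + k ≤ length (us ++ vs) + d
      back rewrite Listₚ.length-++ us {vs} | ∣us∣ | ∣vs∣ = begin
        suc k + e + k         ≤⟨ ℕₚ.+-monoˡ-≤ k (ℕₚ.+-monoʳ-≤ (suc k) e≤) ⟩
        suc k + suc d + k     ≡⟨ move k d ⟩
        suc k + suc k + d     ∎
        where
        move : ∀ k d → suc k + suc d + k ≡ suc k + suc k + d
        move = solve-∀

-- Decomposition into cycles

module _ {V : Set} where

  firsts-links : ∀ (xs : List V) z → map proj₁ (links (xs ∷ʳ z)) ≡ xs
  firsts-links []           z = refl
  firsts-links (x ∷ [])     z = refl
  firsts-links (x ∷ y ∷ xs) z = cong (x ∷_) (firsts-links (y ∷ xs) z)

  seconds-links : ∀ (x : V) xs → map proj₂ (links (x ∷ xs)) ≡ xs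
  seconds-links x []       = refl
  seconds-links x (y ∷ xs) = cong (y ∷_) (seconds-links y xs)

  firsts-arcs : ∀ (c : List V) → map proj₁ (arcs c) ≡ c
  firsts-arcs []       = refl
  firsts-arcs (x ∷ xs) = firsts-links (x ∷ xs) x

  seconds⇒∈ : ∀ {y} (c : List V) → y ∈ map proj₂ (arcs c) → y ∈ c
  seconds⇒∈ (x ∷ xs) y∈ with ∈-++⁻ xs (subst (_ ∈_) (seconds-links x (xs ∷ʳ x)) y∈)
  ... | inj₁ y∈xs        = there y∈xs
  ... | inj₂ (here refl) = here refl

  ∈⇒seconds : ∀ {y} (c : List V) → y ∈ c → y ∈ map proj₂ (arcs c)
  ∈⇒seconds (x ∷ xs) (here refl)  = subst (x ∈_) (≡-sym (seconds-links x (xs ∷ʳ x))) (∈-++⁺ʳ xs (here refl))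
  ∈⇒seconds (x ∷ xs) (there y∈xs) = subst (_ ∈_) (≡-sym (seconds-links x (xs ∷ʳ x))) (∈-++⁺ˡ y∈xs)

  allArcs : List (List V) → List (V × V)
  allArcs = concatMap arcs

  firsts-allArcs : ∀ cs → map proj₁ (allArcs cs) ≡ concat cs
  firsts-allArcs []       = refl
  firsts-allArcs (c ∷ cs) = trans (Listₚ.map-++ proj₁ (arcs c) (allArcs cs))
    (cong₂ _++_ (firsts-arcs c) (firsts-allArcs cs))

  arc-∈ˡ : ∀ {x y} c → (x , y) ∈ arcs c → x ∈ c
  arc-∈ˡ c xy∈ = subst (_ ∈_) (firsts-arcs c) (∈-map⁺ proj₁ xy∈)

  arc-∈ʳ : ∀ {x y} c → (x , y) ∈ arcs c → y ∈ c
  arc-∈ʳ c xy∈ = seconds⇒∈ c (∈-map⁺ proj₂ xy∈)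

  allArcs-∈ˡ : ∀ {x y} cs → (x , y) ∈ allArcs cs → x ∈ concat cs
  allArcs-∈ˡ cs xy∈ = subst (_ ∈_) (firsts-allArcs cs) (∈-map⁺ proj₁ xy∈)

  allArcs-∈ʳ : ∀ {x y} cs → (x , y) ∈ allArcs cs → y ∈ concat cs
  allArcs-∈ʳ (c ∷ cs) xy∈ with ∈-++⁻ (arcs c) xy∈
  ... | inj₁ ∈c  = ∈-++⁺ˡ (arc-∈ʳ c ∈c)
  ... | inj₂ ∈cs = ∈-++⁺ʳ c (allArcs-∈ʳ cs ∈cs)

  successor : ∀ {x} cs → x ∈ concat cs → ∃ λ y → (x , y) ∈ allArcs cs
  successor cs x∈ with ∈-map⁻ proj₁ (subst (_ ∈_) (≡-sym (firsts-allArcs cs)) x∈)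
  ... | (_ , y) , xy∈ , refl = y , xy∈

  predecessor : ∀ {y} cs → y ∈ concat cs → ∃ λ x → (x , y) ∈ allArcs cs
  predecessor (c ∷ cs) y∈ with ∈-++⁻ c y∈
  ... | inj₂ ∈cs = let x , xy∈ = predecessor cs ∈cs in x , ∈-++⁺ʳ (arcs c) xy∈
  ... | inj₁ ∈c with ∈-map⁻ proj₂ (∈⇒seconds c ∈c)
  ...   | (x , _) , xy∈ , refl = x , ∈-++⁺ˡ xy∈

  Unique-++⁻ˡ : ∀ (xs : List V) {ys} → Unique (xs ++ ys) → Unique xs
  Unique-++⁻ˡ []       _       = []
  Unique-++⁻ˡ (x ∷ xs) (p ∷ u) = Allₚ.++⁻ˡ xs p ∷ Unique-++⁻ˡ xs u

  lookup-injective : ∀ {xs : List V} → Unique xs → Injective _≡_ _≡_ (lookup xs)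
  lookup-injective (p ∷ u) {zero}  {zero}  eq = refl
  lookup-injective {xs = _ ∷ xs} (p ∷ u) {zero}  {suc j} eq = contradiction eq (All.lookup p (∈-lookup j))
  lookup-injective {xs = _ ∷ xs} (p ∷ u) {suc i} {zero}  eq = contradiction (≡-sym eq) (All.lookup p (∈-lookup i))
  lookup-injective (p ∷ u) {suc i} {suc j} eq = cong suc (lookup-injective u eq)

  functional : ∀ {x y y′ : V} {ps} → Unique (map proj₁ ps) → (x , y) ∈ ps → (x , y′) ∈ ps → y ≡ y′
  functional u       (here refl) (here refl) = refl
  functional (p ∷ u) (here refl) (there q)   = contradiction refl (All.lookup p (∈-map⁺ proj₁ q))
  functional (p ∷ u) (there q)   (here refl) = contradiction refl (All.lookup p (∈-map⁺ proj₁ q))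
  functional (p ∷ u) (there q)   (there r)   = functional u q r

  links-∈ˡ : ∀ {x y} (xs : List V) → (x , y) ∈ links xs → x ∈ xs
  links-∈ˡ (x ∷ y ∷ xs) (here refl) = here refl
  links-∈ˡ (x ∷ y ∷ xs) (there q)   = there (links-∈ˡ (y ∷ xs) q)

  links-∈ʳ : ∀ {x y} (xs : List V) → (x , y) ∈ links xs → y ∈ xs
  links-∈ʳ (x ∷ y ∷ xs) (here refl) = there (here refl)
  links-∈ʳ (x ∷ y ∷ xs) (there q)   = there (links-∈ʳ (y ∷ xs) q)

  links-asym : ∀ {x y} (xs : List V) → Unique xs → (x , y) ∈ links xs → (y , x) ∉ links xs
  links-asym (a ∷ b ∷ xs) u       (here refl) (here refl) = Unique[x∷xs]⇒x∉xs u (here refl)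
  links-asym (a ∷ b ∷ xs) u       (here refl) (there q)   = Unique[x∷xs]⇒x∉xs u (links-∈ʳ (b ∷ xs) q)
  links-asym (a ∷ b ∷ xs) u       (there p)   (here refl) = Unique[x∷xs]⇒x∉xs u (links-∈ʳ (b ∷ xs) p)
  links-asym (a ∷ b ∷ xs) (_ ∷ u) (there p)   (there q)   = links-asym (b ∷ xs) u p q

  no-return : ∀ {h l : V} t → Unique (h ∷ t ∷ʳ l) → 3 ≤ length (h ∷ t ∷ʳ l) → (h , l) ∉ links (h ∷ t ∷ʳ l)
  no-return []      _       (s≤s (s≤s ()))
  no-return (m ∷ t) (_ ∷ u) _ (here refl) = Unique[x∷xs]⇒x∉xs u (∈-++⁺ʳ t (here refl))
  no-return (m ∷ t) u       _ (there q)   = Unique[x∷xs]⇒x∉xs u (links-∈ˡ (m ∷ t ∷ʳ _) q)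

  -- Links of a list without repetition run in one direction only. A reverse pair would therefore
  -- involve the closing arc, which leads from the last vertex to the head; but no link leads from
  -- the head to the last vertex when there are at least three.
  arcs-asym : ∀ {x y} (c : List V) → Unique c → 3 ≤ length c → (x , y) ∈ arcs c → (y , x) ∉ arcs c
  arcs-asym (h ∷ q) u 3≤ p r with initLast q
  arcs-asym (h ∷ .[]) u (s≤s ()) p r | []
  arcs-asym (h ∷ .(t ∷ʳ l)) u 3≤ p r | t ∷ʳ′ l
    rewrite links-∷ʳ (h ∷ t) l h with ∈-++⁻ (links (h ∷ t ∷ʳ l)) p | ∈-++⁻ (links (h ∷ t ∷ʳ l)) r
  ... | inj₁ p′          | inj₁ r′          = links-asym (h ∷ t ∷ʳ l) u p′ r′
  ... | inj₁ p′          | inj₂ (here refl) = no-return t u 3≤ p′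
  ... | inj₂ (here refl) | inj₁ r′          = no-return t u 3≤ r′
  ... | inj₂ (here refl) | inj₂ (here eq)   = Unique[x∷xs]⇒x∉xs u (subst (_∈ t ∷ʳ l) (≡-sym (cong proj₁ eq)) (∈-++⁺ʳ t (here refl)))

  links-++ : ∀ (xs : List V) w ys → links (xs ++ w ∷ ys) ≡ links (xs ∷ʳ w) ++ links (w ∷ ys)
  links-++ []           w ys = refl
  links-++ (x ∷ [])     w ys = refl
  links-++ (x ∷ y ∷ xs) w ys = cong ((x , y) ∷_) (links-++ (y ∷ xs) w ys)

  length-concat : ∀ (cs : List (List V)) → length (concat cs) ≡ total cs
  length-concat []       = refl
  length-concat (c ∷ cs) = trans (Listₚ.length-++ c) (cong (length c +_) (length-concat cs))

module _ {n : ℕ} where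

  Unique-length : ∀ {xs : List (Fin n)} → Unique xs → length xs ≤ n
  Unique-length u = Finₚ.injective⇒≤ (lookup-injective u)

  complete-length : ∀ {xs : List (Fin n)} → (∀ v → v ∈ xs) → n ≤ length xs
  complete-length {xs} all∈ = Finₚ.injective⇒≤ {f = λ v → Any.index (all∈ v)} λ {v} {w} eq →
    trans (Anyₚ.lookup-index (all∈ v)) (trans (cong (lookup xs) eq) (≡-sym (Anyₚ.lookup-index (all∈ w))))

-- The hypothesis `other` is 2-regularity in the form in which it is used: a walk that enters a
-- vertex by one edge leaves it by the only other one.
module Tracing {n : ℕ} (E : Fin n → Fin n → Set)
  (E-sym : ∀ {u v} → E u v → E v u) (E-irrefl : ∀ {u} → ¬ E u u)
  (other : ∀ {u p} → E u p → ∃ λ q → q ≢ p × E u q × (∀ {w} → E u w → w ≡ p ⊎ w ≡ q))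
  (neighbour : ∀ u → ∃ (E u)) where

  open DecMembership (Fin._≟_ {n}) using (_∈?_)

  record Cycles (cs : List (List (Fin n))) : Set where
    field
      unique : Unique (concat cs)
      long   : All (λ c → 3 ≤ length c) cs
      edges  : ∀ {x y} → (x , y) ∈ allArcs cs → E x y
      asym   : ∀ {x y} → (x , y) ∈ allArcs cs → (y , x) ∉ allArcs cs

  open Cycles

  -- By `asym` the predecessor and the successor of `v` are distinct, so they exhaust its two
  -- neighbours.
  saturated : ∀ {cs} → Cycles cs → ∀ {v w} → v ∈ concat cs → E v w →
    (v , w) ∈ allArcs cs ⊎ (w , v) ∈ allArcs cs
  saturated {cs} Z {v} {w} v∈ vw with predecessor cs v∈ | successor cs v∈
  ... | p , pv∈ | q , vq∈ with other (E-sym (edges Z pv∈))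
  ... | q′ , _ , _ , only with only (edges Z vq∈) | only vw
  ... | inj₁ refl | _         = contradiction vq∈ (asym Z pv∈)
  ... | inj₂ refl | inj₁ refl = inj₂ pv∈
  ... | inj₂ refl | inj₂ refl = inj₁ vq∈

  closed : ∀ {cs} → Cycles cs → ∀ {v w} → v ∈ concat cs → E v w → w ∈ concat cs
  closed {cs} Z v∈ vw with saturated Z v∈ vw
  ... | inj₁ p = allArcs-∈ʳ cs p
  ... | inj₂ p = allArcs-∈ˡ cs p

  -- If u ≢ v, the successor of w would be a third neighbour of w.
  predecessor-unique : ∀ {cs} → Cycles cs → ∀ {u v w} → (u , w) ∈ allArcs cs → (v , w) ∈ allArcs cs → u ≡ v
  predecessor-unique {cs} Z uw vw with successor cs (allArcs-∈ʳ cs uw) | other (E-sym (edges Z uw))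
  ... | z , wz | q , _ , _ , only with only (E-sym (edges Z vw)) | only (edges Z wz)
  ...   | inj₁ v≡u  | _         = ≡-sym v≡u
  ...   | inj₂ refl | inj₁ refl = contradiction wz (asym Z uw)
  ...   | inj₂ refl | inj₂ refl = contradiction wz (asym Z vw)

  -- A path extended without backtracking either meets a new vertex or hits itself; in the latter
  -- case the part of the path since that hit is a cycle.
  module _ {D : List (Fin n)} (D-closed : ∀ {v w} → v ∈ D → E v w → w ∈ D) where

    Found : Set
    Found = ∃ λ c → Unique c × 3 ≤ length c × All (uncurry E) (arcs c) × All (_∉ D) c

    trace : ∀ k h h′ t → n < k + length (h ∷ h′ ∷ t) → Unique (h ∷ h′ ∷ t) →
      All (uncurry E) (links (h ∷ h′ ∷ t)) → All (_∉ D) (h ∷ h′ ∷ t) → Found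
    -- The fuel and the length of the path always exceed `n` together; without fuel the path alone
    -- would have more than `n` distinct vertices.
    trace zero h h′ t n< u es ∉D = contradiction (Unique-length u) (ℕₚ.<⇒≱ n<)
    trace (suc k) h h′ t n< u es@(hh′ ∷ _) ∉D@(h∉D ∷ _) with other hh′
    ... | w , w≢h′ , hw , _ with w ∈? t
    ...   | no w∉t = trace k w h (h′ ∷ t) (subst (n <_) (≡-sym (ℕₚ.+-suc k _)) n<)
      ((w≢h ∷ w≢h′ ∷ Allₚ.¬Any⇒All¬ t w∉t) ∷ u) (E-sym hw ∷ es) ((λ w∈D → h∉D (D-closed w∈D (E-sym hw))) ∷ ∉D)
      where
      w≢h : w ≢ h
      w≢h refl = E-irrefl hw
    ...   | yes w∈t with ∈-∃++ w∈t
    -- As `w` lies behind `h′`, the part up to `w` has at least the three vertices `h`, `h′` and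
    -- `w`; the edge from `w` to `h` closes it.
    ...     | pre , post , refl = h ∷ h′ ∷ pre ∷ʳ w ,
      Unique-++⁻ˡ (h ∷ h′ ∷ pre ∷ʳ w) (subst Unique cut u) ,
      s≤s (s≤s (subst (1 ≤_) (≡-sym (trans (Listₚ.length-++ pre) (ℕₚ.+-comm _ 1))) (s≤s z≤n))) ,
      subst (All _) (≡-sym (links-∷ʳ (h ∷ h′ ∷ pre) w h))
        (Allₚ.++⁺ (Allₚ.++⁻ˡ (links (h ∷ h′ ∷ pre ∷ʳ w)) (subst (All _) (links-++ (h ∷ h′ ∷ pre) w post) es)) (E-sym hw ∷ [])) ,
      Allₚ.++⁻ˡ (h ∷ h′ ∷ pre ∷ʳ w) (subst (All _) cut ∉D)
      where
      cut : h ∷ h′ ∷ pre ++ w ∷ post ≡ (h ∷ h′ ∷ pre ∷ʳ w) ++ post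
      cut = ≡-sym (Listₚ.∷ʳ-++ (h ∷ h′ ∷ pre) w post)

    find : ∀ {v} → v ∉ D → Found
    find {v} v∉D with neighbour v
    ... | x , vx = trace n x v [] (ℕₚ.m<m+n n (s≤s z≤n)) (((λ { refl → E-irrefl vx }) ∷ []) ∷ [] ∷ [])
      (E-sym vx ∷ []) ((λ x∈D → v∉D (D-closed x∈D (E-sym vx))) ∷ v∉D ∷ [])

  addCycle : ∀ {cs v} → Cycles cs → v ∉ concat cs → ∃ λ c → Cycles (c ∷ cs) × 1 ≤ length c
  addCycle {cs} Z v∉ with find (closed Z) v∉
  ... | c , u , 3≤ , es , ∉D = c , record
    { unique = Uniqueₚ.++⁺ u (unique Z) λ { (∈c , ∈D) → All.lookup ∉D ∈c ∈D }
    ; long   = 3≤ ∷ long Z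
    ; edges  = λ p → Sum.[ All.lookup es , edges Z ] (∈-++⁻ (arcs c) p)
    ; asym   = asym′
    } , ℕₚ.≤-trans (s≤s z≤n) 3≤
    where
    asym′ : ∀ {x y} → (x , y) ∈ allArcs (c ∷ cs) → (y , x) ∉ allArcs (c ∷ cs)
    asym′ p q with ∈-++⁻ (arcs c) p | ∈-++⁻ (arcs c) q
    ... | inj₁ p′ | inj₁ q′ = arcs-asym c u 3≤ p′ q′
    ... | inj₁ p′ | inj₂ q′ = All.lookup ∉D (arc-∈ˡ c p′) (allArcs-∈ʳ cs q′)
    ... | inj₂ p′ | inj₁ q′ = All.lookup ∉D (arc-∈ˡ c q′) (allArcs-∈ʳ cs p′)
    ... | inj₂ p′ | inj₂ q′ = asym Z p′ q′

  decompose : ∃ λ cs → Cycles cs × (∀ v → v ∈ concat cs)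
  decompose = go (suc n) [] (record { unique = [] ; long = [] ; edges = λ () ; asym = λ () }) (s≤s (ℕₚ.m≤m+n n 0))
    where
    go : ∀ k cs → Cycles cs → n < k + length (concat cs) → ∃ λ cs → Cycles cs × (∀ v → v ∈ concat cs)
    -- Fuel again: each new cycle covers at least one more vertex, and covered vertices are
    -- distinct.
    go zero    cs Z n< = contradiction (Unique-length (unique Z)) (ℕₚ.<⇒≱ n<)
    go (suc k) cs Z n< with Finₚ.any? (λ v → ¬? (v ∈? concat cs))
    ... | no ∄ = cs , Z , λ v → decidable-stable (v ∈? concat cs) λ v∉ → ∄ (v , v∉)
    ... | yes (v , v∉) with addCycle Z v∉
    ...   | c , Z′ , 1≤ = go k (c ∷ cs) Z′ (begin-strict
      n                                   <⟨ n< ⟩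
      suc k + length (concat cs)          ≡⟨ ≡-sym (ℕₚ.+-suc k _) ⟩
      k + (1 + length (concat cs))        ≤⟨ ℕₚ.+-monoʳ-≤ k (ℕₚ.+-monoˡ-≤ _ 1≤) ⟩
      k + (length c + length (concat cs)) ≡⟨ cong (k +_) (≡-sym (Listₚ.length-++ c)) ⟩
      k + length (concat (c ∷ cs))        ∎)
      where open ℕₚ.≤-Reasoning

-- Counting neighbours

module _ {V : Set} (f : V → Bool) where

  -- For `f = adj G u` and `xs = allFin n` this is `degree G u` by definition, so that `Regular 2 G`
  -- can be passed to the lemmas below as it stands.
  count : List V → ℕ
  count xs = sum (map (λ v → if f v then 1 else 0) xs)

  count≡0 : ∀ xs → count xs ≡ 0 → ∀ {v} → v ∈ xs → f v ≢ true
  count≡0 (x ∷ xs) eq v∈ fv with f x in fx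
  count≡0 (x ∷ xs) () v∈ fv          | true
  count≡0 (x ∷ xs) eq (here refl) fv | false = contradiction (trans (≡-sym fx) fv) λ ()
  count≡0 (x ∷ xs) eq (there v∈) fv  | false = count≡0 xs eq v∈ fv

  count≡1 : ∀ xs → count xs ≡ 1 → ∃ λ a → a ∈ xs × f a ≡ true × (∀ {v} → v ∈ xs → f v ≡ true → v ≡ a)
  count≡1 (x ∷ xs) eq with f x in fx
  ... | true = x , here refl , fx , λ where
    (here refl) _  → refl
    (there v∈)  fv → contradiction fv (count≡0 xs (ℕₚ.suc-injective eq) v∈)
  ... | false = let a , a∈ , fa , only = count≡1 xs eq in a , there a∈ , fa , λ where
    (here refl) fv → contradiction (trans (≡-sym fx) fv) λ ()
    (there v∈)  fv → only v∈ fv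

  count>0 : ∀ xs → 0 < count xs → ∃ λ a → f a ≡ true
  count>0 (x ∷ xs) lt with f x in fx
  ... | true  = x , fx
  ... | false = count>0 xs lt

  count≡2 : ∀ {xs p} → Unique xs → count xs ≡ 2 → p ∈ xs → f p ≡ true →
    ∃ λ q → q ≢ p × f q ≡ true × (∀ {v} → v ∈ xs → f v ≡ true → v ≡ p ⊎ v ≡ q)
  count≡2 {x ∷ xs} (x∉ ∷ u) eq p∈ fp with f x in fx
  count≡2 {x ∷ xs} (x∉ ∷ u) eq (here refl) fp | true =
    let q , q∈ , fq , only = count≡1 xs (ℕₚ.suc-injective eq)
    in q , (λ { refl → All.lookup x∉ q∈ refl }) , fq , λ where
      (here refl) _  → inj₁ refl
      (there v∈)  fv → inj₂ (only v∈ fv)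
  count≡2 {x ∷ xs} {p} (x∉ ∷ u) eq (there p∈) fp | true =
    let a , a∈ , fa , only = count≡1 xs (ℕₚ.suc-injective eq)
    in x , All.lookup x∉ p∈ , fx , λ where
      (here refl) _  → inj₂ refl
      (there v∈)  fv → inj₁ (trans (only v∈ fv) (≡-sym (only p∈ fp)))
  count≡2 {x ∷ xs} (x∉ ∷ u) eq (here refl) fp | false = contradiction (trans (≡-sym fx) fp) λ ()
  count≡2 {x ∷ xs} (x∉ ∷ u) eq (there p∈) fp  | false =
    let q , q≢p , fq , only = count≡2 u eq p∈ fp
    in q , q≢p , fq , λ where
      (here refl) fv → contradiction (trans (≡-sym fx) fv) λ ()
      (there v∈)  fv → only v∈ fv

  none⇒count≡0 : ∀ xs → (∀ {v} → v ∈ xs → f v ≢ true) → count xs ≡ 0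
  none⇒count≡0 []       ∄ = refl
  none⇒count≡0 (x ∷ xs) ∄ with f x in fx
  ... | true  = contradiction fx (∄ (here refl))
  ... | false = none⇒count≡0 xs (∄ ∘ there)

  one⇒count≡1 : ∀ {xs a} → Unique xs → a ∈ xs → f a ≡ true →
    (∀ {v} → v ∈ xs → f v ≡ true → v ≡ a) → count xs ≡ 1
  one⇒count≡1 {x ∷ xs} (x∉ ∷ u) a∈ fa only with f x in fx
  one⇒count≡1 {x ∷ xs} (x∉ ∷ u) a∈ fa only | true = cong suc (none⇒count≡0 xs λ v∈ fv →
    All.lookup x∉ v∈ (trans (only (here refl) fx) (≡-sym (only (there v∈) fv))))
  one⇒count≡1 {x ∷ xs} (x∉ ∷ u) (here refl) fa only | false = contradiction (trans (≡-sym fx) fa) λ ()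
  one⇒count≡1 {x ∷ xs} (x∉ ∷ u) (there a∈) fa only  | false = one⇒count≡1 u a∈ fa (only ∘ there)

  two⇒count≡2 : ∀ {xs a b} → Unique xs → a ∈ xs → b ∈ xs → a ≢ b → f a ≡ true → f b ≡ true →
    (∀ {v} → v ∈ xs → f v ≡ true → v ≡ a ⊎ v ≡ b) → count xs ≡ 2
  two⇒count≡2 {x ∷ xs} u (here refl) (here refl) a≢b fa fb only = contradiction refl a≢b
  two⇒count≡2 {x ∷ xs} (x∉ ∷ u) (here refl) (there b∈) a≢b fa fb only rewrite fa =
    cong suc (one⇒count≡1 u b∈ fb λ v∈ fv → Sum.[ (λ { refl → contradiction refl (All.lookup x∉ v∈) }) , (λ eq → eq) ] (only (there v∈) fv))
  two⇒count≡2 {x ∷ xs} (x∉ ∷ u) (there a∈) (here refl) a≢b fa fb only rewrite fb =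
    cong suc (one⇒count≡1 u a∈ fa λ v∈ fv → Sum.[ (λ eq → eq) , (λ { refl → contradiction refl (All.lookup x∉ v∈) }) ] (only (there v∈) fv))
  two⇒count≡2 {x ∷ xs} (x∉ ∷ u) (there a∈) (there b∈) a≢b fa fb only with f x in fx
  ... | false = two⇒count≡2 u a∈ b∈ a≢b fa fb (only ∘ there)
  ... | true with only (here refl) fx
  ...   | inj₁ refl = contradiction refl (All.lookup x∉ a∈)
  ...   | inj₂ refl = contradiction refl (All.lookup x∉ b∈)

-- Oriented 2-regular graphs

-- The common interface of arbitrary 2-regular graphs, where `σ` comes from the decomposition, and
-- of the extremal graphs, which are defined from a permutation.
record Orientation {n : ℕ} (G : Graph n) : Set where
  field
    σ         : Fin n → Fin n
    out       : ∀ u → adj G u (σ u) ≡ true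
    split     : ∀ {u v} → adj G u v ≡ true → v ≡ σ u ⊎ u ≡ σ v
    asym      : ∀ u → σ (σ u) ≢ u
    injective : Injective _≡_ _≡_ σ

module _ {n : ℕ} (G : Graph n) where

  edge-≡ : {e e′ : Edge G} → proj₁ e ≡ proj₁ e′ → e ≡ e′
  edge-≡ {p , lt , a} {.p , lt′ , a′} refl =
    cong₂ (λ l b → p , l , b) (Finₚ.<-irrelevant lt lt′) (Decidable⇒UIP.≡-irrelevant Boolₚ._≟_ a a′)

module Tails {n : ℕ} {G : Graph n} (O : Orientation G) where
  open Orientation O

  fixfree : ∀ u → σ u ≢ u
  fixfree u eq = asym u (trans (cong σ eq) eq)

  tail : Edge G → Fin n
  tail ((u , v) , _) with v Fin.≟ σ u
  ... | yes _ = u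
  ... | no  _ = v

  tail-spec : ∀ (e : Edge G) → let (u , v) , _ = e in
    (tail e ≡ u × v ≡ σ u) ⊎ (tail e ≡ v × u ≡ σ v)
  tail-spec ((u , v) , _ , uv) with v Fin.≟ σ u
  ... | yes eq = inj₁ (refl , eq)
  ... | no v≢ with split uv
  ...   | inj₁ eq = contradiction eq v≢
  ...   | inj₂ eq = inj₂ (refl , eq)

  -- Both edges join the common tail `t` to `σ t`. They cannot list these ends in opposite orders,
  -- since each lists the smaller end first.
  tail-injective : Injective _≡_ _≡_ tail
  tail-injective {e@(_ , u<v , _)} {e′@(_ , u′<v′ , _)} eq with tail-spec e | tail-spec e′
  ... | inj₁ (t , refl) | inj₁ (t′ , refl) with trans (≡-sym t) (trans eq t′)
  ...   | refl = edge-≡ G {e} {e′} refl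
  tail-injective {e@(_ , u<v , _)} {e′@(_ , u′<v′ , _)} eq | inj₂ (t , refl) | inj₂ (t′ , refl) with trans (≡-sym t) (trans eq t′)
  ...   | refl = edge-≡ G {e} {e′} refl
  tail-injective {e@(_ , u<v , _)} {e′@(_ , u′<v′ , _)} eq | inj₁ (t , refl) | inj₂ (t′ , refl) with trans (≡-sym t) (trans eq t′)
  ...   | refl = contradiction u′<v′ (ℕₚ.<-asym u<v)
  tail-injective {e@(_ , u<v , _)} {e′@(_ , u′<v′ , _)} eq | inj₂ (t , refl) | inj₁ (t′ , refl) with trans (≡-sym t) (trans eq t′)
  ...   | refl = contradiction u′<v′ (ℕₚ.<-asym u<v)

  edgeAt : ∀ u → ∃ λ e → tail e ≡ u
  edgeAt u with Finₚ.<-cmp u (σ u)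
  ... | tri≈ _ eq _ = contradiction (≡-sym eq) (fixfree u)
  ... | tri< lt _ _ = e , at (tail-spec e)
    where
    e : Edge G
    e = (u , σ u) , lt , out u
    at : (tail e ≡ u × σ u ≡ σ u) ⊎ (tail e ≡ σ u × u ≡ σ (σ u)) → tail e ≡ u
    at (inj₁ (t , _)) = t
    at (inj₂ (_ , q)) = contradiction (≡-sym q) (asym u)
  ... | tri> _ _ gt = e , at (tail-spec e)
    where
    e : Edge G
    e = (σ u , u) , gt , trans (Graph.sym G (σ u) u) (out u)
    at : (tail e ≡ σ u × u ≡ σ (σ u)) ⊎ (tail e ≡ u × σ u ≡ σ u) → tail e ≡ u
    at (inj₁ (_ , q)) = contradiction (≡-sym q) (asym u)
    at (inj₂ (t , _)) = t

  Consecutive : Edge G → Edge G → Set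
  Consecutive e e′ = tail e′ ≡ σ (tail e)

  -- Each end of an edge is its tail or `σ` of its tail. The shared vertex cannot be the tail of
  -- both edges, nor the head of both by injectivity of `σ`, so it is the head of one and the tail
  -- of the other.
  adjacent⇒consecutive : ∀ {e e′} → Adjacent {G = G} e e′ → Consecutive e e′ ⊎ Consecutive e′ e
  adjacent⇒consecutive {e@((u , v) , _)} {e′@((u′ , v′) , _)} (distinct , share) = case share
    where
    endˡ : ∀ (e : Edge G) → proj₁ (proj₁ e) ≡ tail e ⊎ proj₁ (proj₁ e) ≡ σ (tail e)
    endˡ e with tail-spec e
    ... | inj₁ (t , _) = inj₁ (≡-sym t)
    ... | inj₂ (t , q) = inj₂ (trans q (cong σ (≡-sym t)))
    endʳ : ∀ (e : Edge G) → proj₂ (proj₁ e) ≡ tail e ⊎ proj₂ (proj₁ e) ≡ σ (tail e)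
    endʳ e with tail-spec e
    ... | inj₁ (t , q) = inj₂ (trans q (cong σ (≡-sym t)))
    ... | inj₂ (t , _) = inj₁ (≡-sym t)
    differ : tail e ≢ tail e′
    differ = distinct ∘ cong proj₁ ∘ tail-injective {e} {e′}
    meet : ∀ {x y} → x ≡ y → x ≡ tail e ⊎ x ≡ σ (tail e) → y ≡ tail e′ ⊎ y ≡ σ (tail e′) →
      Consecutive e e′ ⊎ Consecutive e′ e
    meet refl (inj₁ p) (inj₁ q) = contradiction (trans (≡-sym p) q) differ
    meet refl (inj₁ p) (inj₂ q) = inj₂ (trans (≡-sym p) q)
    meet refl (inj₂ p) (inj₁ q) = inj₁ (trans (≡-sym q) p)
    meet refl (inj₂ p) (inj₂ q) = contradiction (injective (trans (≡-sym p) q)) differ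
    case : u ≡ u′ ⊎ u ≡ v′ ⊎ v ≡ u′ ⊎ v ≡ v′ → Consecutive e e′ ⊎ Consecutive e′ e
    case (inj₁ eq)               = meet eq (endˡ e) (endˡ e′)
    case (inj₂ (inj₁ eq))        = meet eq (endˡ e) (endʳ e′)
    case (inj₂ (inj₂ (inj₁ eq))) = meet eq (endʳ e) (endˡ e′)
    case (inj₂ (inj₂ (inj₂ eq))) = meet eq (endʳ e) (endʳ e′)

  consecutive⇒adjacent : ∀ {e e′} → Consecutive e e′ → Adjacent {G = G} e e′
  consecutive⇒adjacent {e} {e′} c = differ , share (tail-spec e) (tail-spec e′)
    where
    differ : proj₁ e ≢ proj₁ e′
    differ eq = fixfree (tail e) (trans (≡-sym c) (cong tail (≡-sym (edge-≡ G {e} {e′} eq))))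
    share : ∀ {u v u′ v′} → (tail e ≡ u × v ≡ σ u) ⊎ (tail e ≡ v × u ≡ σ v) →
      (tail e′ ≡ u′ × v′ ≡ σ u′) ⊎ (tail e′ ≡ v′ × u′ ≡ σ v′) →
      u ≡ u′ ⊎ u ≡ v′ ⊎ v ≡ u′ ⊎ v ≡ v′
    share (inj₁ (refl , q)) (inj₁ (refl , _)) = inj₂ (inj₂ (inj₁ (trans q (≡-sym c))))
    share (inj₁ (refl , q)) (inj₂ (refl , _)) = inj₂ (inj₂ (inj₂ (trans q (≡-sym c))))
    share (inj₂ (refl , q)) (inj₁ (refl , _)) = inj₁ (trans q (≡-sym c))
    share (inj₂ (refl , q)) (inj₂ (refl , _)) = inj₂ (inj₁ (trans q (≡-sym c)))

  -- Edges correspond to their tails, so there are as many edges as vertices.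
  ordering-size : ∀ {m} → Ordering G m → m ≡ n
  ordering-size ℓ = Finₚ.cantor-schröder-bernstein {f = tail ∘ from} {g = to ∘ proj₁ ∘ edgeAt}
    (λ {i} {j} eq → trans (≡-sym (to-from i)) (trans (cong to (tail-injective {from i} {from j} eq)) (to-from j)))
    (λ {u} {v} eq → trans (≡-sym (proj₂ (edgeAt u))) (trans (cong tail (Bijection.injective ℓ eq)) (proj₂ (edgeAt v))))
    where
    open Bijection ℓ using (to)
    from = λ i → proj₁ (Bijection.strictlySurjective ℓ i)
    to-from = λ i → proj₂ (Bijection.strictlySurjective ℓ i)

-- A missed value, added as the image of one more argument, would give an injection from
-- `Fin (suc n)` into `Fin m`.
injective⇒surjective : ∀ {m n} {f : Fin n → Fin m} → m ≤ n → Injective _≡_ _≡_ f → ∀ i → ∃ λ v → f v ≡ i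
injective⇒surjective {m} {n} {f} m≤n inj i with Finₚ.any? (λ v → f v Fin.≟ i)
... | yes found = found
... | no ∄ = contradiction (Finₚ.injective⇒≤ {f = g} g-injective) (ℕₚ.≤⇒≯ m≤n)
  where
  g : Fin (suc n) → Fin m
  g zero    = i
  g (suc v) = f v
  g-injective : Injective _≡_ _≡_ g
  g-injective {zero}  {zero}  eq = refl
  g-injective {zero}  {suc v} eq = contradiction (v , ≡-sym eq) ∄
  g-injective {suc v} {zero}  eq = contradiction (v , eq) ∄
  g-injective {suc v} {suc w} eq = cong suc (inj eq)

-- Cyclic distances, and orderings from arrangements

fwd-< : ∀ {m} {a b : Fin m} → toℕ a < toℕ b → fwd a b ≡ toℕ b ∸ toℕ a
fwd-< {a = a} {b} lt with toℕ a <ᵇ toℕ b | ℕₚ.<⇒<ᵇ lt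
... | true | _ = refl

fwd-≥ : ∀ {m} {a b : Fin m} → toℕ b ≤ toℕ a → fwd a b ≡ (m + toℕ b) ∸ toℕ a
fwd-≥ {a = a} {b} ge with toℕ a <ᵇ toℕ b in eq
... | true  = contradiction ge (ℕₚ.<⇒≱ (ℕₚ.<ᵇ⇒< _ _ (subst T (≡-sym eq) _)))
... | false = refl

dist-comm : ∀ {m} (a b : Fin m) → dist a b ≡ dist b a
dist-comm a b = ℕₚ.⊓-comm (fwd a b) (fwd b a)

dist-intro : ∀ {m s} {a b : Fin m} → s + toℕ a ≤ toℕ b → toℕ b + s ≤ m + toℕ a → s ≤ dist a b
dist-intro {m} {s} {a} {b} far back = ℕₚ.⊓-glb forward backward
  where
  forward : s ≤ fwd a b
  forward with toℕ a <ᵇ toℕ b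
  ... | true  = ℕₚ.m+n≤o⇒m≤o∸n s far
  -- By `far` this case occurs only if `s` is 0 and the positions coincide.
  ... | false = ℕₚ.m+n≤o⇒m≤o∸n s (ℕₚ.m≤n⇒m≤o+n m far)
  backward : s ≤ fwd b a
  backward = subst (s ≤_) (≡-sym (fwd-≥ {a = b} {a} (ℕₚ.m+n≤o⇒n≤o s far)))
    (ℕₚ.m+n≤o⇒m≤o∸n s (subst (_≤ m + toℕ a) (ℕₚ.+-comm (toℕ b) s) back))

dist-elim : ∀ {m s} {a b : Fin m} → toℕ a < toℕ b → s ≤ dist a b →
  s + toℕ a ≤ toℕ b × toℕ b + s ≤ m + toℕ a
dist-elim {m} {s} {a} {b} lt s≤ =
  subst (s + toℕ a ≤_) (ℕₚ.m∸n+n≡m (ℕₚ.<⇒≤ lt))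
    (ℕₚ.+-monoˡ-≤ (toℕ a) (subst (s ≤_) (fwd-< {a = a} {b} lt) (ℕₚ.m≤n⊓o⇒m≤n (fwd a b) (fwd b a) s≤))) ,
  subst₂ _≤_ (ℕₚ.+-comm s (toℕ b)) (ℕₚ.m∸n+n≡m (ℕₚ.≤-trans (ℕₚ.<⇒≤ (Finₚ.toℕ<n b)) (ℕₚ.m≤m+n m (toℕ a))))
    (ℕₚ.+-monoˡ-≤ (toℕ b) (subst (s ≤_) (fwd-≥ {a = b} {a} (ℕₚ.<⇒≤ lt)) (ℕₚ.m≤n⊓o⇒m≤o (fwd a b) (fwd b a) s≤)))

HasSpread : ∀ {n} → Graph n → ℕ → Set
HasSpread G s = ∃ λ m → Σ (Ordering G m) λ ℓ → Spread {G = G} ℓ s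

Spread-≤ : ∀ {n m} {G : Graph n} {ℓ : Ordering G m} {s t} → t ≤ s → Spread {G = G} ℓ s → Spread {G = G} ℓ t
Spread-≤ t≤s sp e e′ a = ℕₚ.≤-trans t≤s (sp e e′ a)

nth⇒lookup : ∀ {V : Set} (xs : List V) {i x} → nth xs i ≡ just x → ∃ λ k → toℕ k ≡ i × lookup xs k ≡ x
nth⇒lookup (x ∷ xs) {zero}  refl = zero , refl , refl
nth⇒lookup (x ∷ xs) {suc i} eq   = let k , p , q = nth⇒lookup xs eq in suc k , cong suc p , q

module _ {n : ℕ} {G : Graph n} (O : Orientation G) where
  open Orientation O
  open Tails O

  -- The spacing of `u` and `σ u` shows in particular that `u` occurs in `xs`. Since there are only
  -- `n` positions, no vertex occurs twice, and hence the positions named in `Ahead` are those of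
  -- the ordering.
  spaced⇒HasSpread : ∀ {s} (xs : List (Fin n)) → length xs ≡ n → (∀ u → Spaced s xs u (σ u)) → HasSpread G s
  spaced⇒HasSpread {s} xs len spaced = length xs , mk⤖ {to = pos ∘ tail} (inj , surj) , spread
    where
    place : ∀ u → ∃ λ k → lookup xs k ≡ u
    place u with spaced u
    ... | inj₁ a = let k , _ , q = nth⇒lookup xs (Ahead.atˣ a) in k , q
    ... | inj₂ a = let k , _ , q = nth⇒lookup xs (Ahead.atʸ a) in k , q
    pos : Fin n → Fin (length xs)
    pos u = proj₁ (place u)
    pos-injective : Injective _≡_ _≡_ pos
    pos-injective {u} {v} eq = trans (≡-sym (proj₂ (place u))) (trans (cong (lookup xs) eq) (proj₂ (place v)))
    pos-surjective : ∀ i → ∃ λ u → pos u ≡ i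
    pos-surjective = injective⇒surjective (ℕₚ.≤-reflexive len) pos-injective
    pos-lookup : ∀ i → pos (lookup xs i) ≡ i
    pos-lookup i with pos-surjective i
    ... | u , refl = cong pos (proj₂ (place u))
    inj : Injective _≡_ _≡_ (pos ∘ tail)
    inj {e} {e′} eq = tail-injective {e} {e′} (pos-injective eq)
    surj = strictlySurjective⇒surjective λ i →
      let u , p = pos-surjective i
          e , q = edgeAt u
      in e , trans (cong pos q) p
    located : ∀ {i x} → nth xs i ≡ just x → toℕ (pos x) ≡ i
    located at with nth⇒lookup xs at
    ... | k , refl , refl = cong toℕ (pos-lookup k)
    apart : ∀ {x y} → Ahead s xs x y → s ≤ dist (pos x) (pos y)
    apart {x} {y} (ahead i j atˣ atʸ far back) =
      dist-intro {a = pos x} {pos y}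
        (subst₂ (λ i j → s + i ≤ j) (≡-sym (located atˣ)) (≡-sym (located atʸ)) far)
        (subst₂ (λ i j → j + s ≤ length xs + i) (≡-sym (located atˣ)) (≡-sym (located atʸ)) back)
    apart′ : ∀ {x y} → Spaced s xs x y → s ≤ dist (pos x) (pos y)
    apart′ (inj₁ a) = apart a
    apart′ {x} {y} (inj₂ a) = subst (s ≤_) (dist-comm (pos y) (pos x)) (apart a)
    spread : ∀ e e′ → Adjacent {G = G} e e′ → s ≤ dist (pos (tail e)) (pos (tail e′))
    spread e e′ a with adjacent⇒consecutive {e} {e′} a
    ... | inj₁ c = subst (λ v → s ≤ dist (pos (tail e)) (pos v)) (≡-sym c) (apart′ (spaced (tail e)))
    ... | inj₂ c = subst (s ≤_) (dist-comm (pos (tail e′)) (pos (tail e)))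
      (subst (λ v → s ≤ dist (pos (tail e′)) (pos v)) (≡-sym c) (apart′ (spaced (tail e′))))

  -- The largest spread of an ordering is not computed. Its existence is shown only up to double
  -- negation, which is enough in `cms-≥`, where the goal is a decidable inequality. The induction
  -- is on `k`, which bounds the room between `s` and `m`.
  maximalSpread : ∀ {m s} (ℓ : Ordering G m) k → m ≤ s + k → 1 ≤ s → s ≤ m → Spread {G = G} ℓ s →
    ¬ ¬ (∃ λ t → s ≤ t × IsCmsOrd {G = G} ℓ t)
  maximalSpread {m} {s} ℓ k m≤ 1≤s s≤m sp ∄ = ∄ (s , ℕₚ.≤-refl , 1≤s , s≤m , sp , maximal k m≤)
    where
    maximal : ∀ k → m ≤ s + k → ∀ t → 1 ≤ t → t ≤ m → Spread {G = G} ℓ t → t ≤ s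
    maximal zero m≤ t _ t≤m _ = ℕₚ.≤-trans t≤m (subst (m ≤_) (ℕₚ.+-identityʳ s) m≤)
    maximal (suc k) m≤ t _ t≤m tp = ℕₚ.≮⇒≥ λ s<t →
      maximalSpread ℓ k (subst (m ≤_) (ℕₚ.+-suc s k) m≤) (s≤s z≤n) (ℕₚ.≤-trans s<t t≤m)
        (Spread-≤ {G = G} {ℓ} s<t tp) λ (t , s<t , c) → ∄ (t , ℕₚ.<⇒≤ s<t , c)

  cms-≥ : ∀ {s t} → 1 ≤ s → s ≤ n → HasSpread G s → IsCmsGraph G t → s ≤ t
  cms-≥ {s} {t} 1≤s s≤n (m , ℓ , sp) (_ , upper) = decidable-stable (s ℕₚ.≤? t) λ s≰t →
    maximalSpread ℓ m (ℕₚ.m≤n+m m s) 1≤s (subst (s ≤_) (≡-sym (ordering-size ℓ)) s≤n) sp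
      λ (u , s≤u , c) → s≰t (ℕₚ.≤-trans s≤u (upper m ℓ u c))

  cms-≡ : ∀ {s} → 1 ≤ s → s ≤ n → HasSpread G s →
    (∀ {m} (ℓ : Ordering G m) t → Spread {G = G} ℓ t → t ≤ s) → IsCmsGraph G s
  cms-≡ {s} 1≤s s≤n (m , ℓ , sp) upper =
    (m , ℓ , 1≤s , subst (s ≤_) (≡-sym (ordering-size ℓ)) s≤n , sp , λ t _ _ → upper ℓ t) ,
    λ _ ℓ t c → upper ℓ t (proj₁ (proj₂ (proj₂ c)))

-- Lower bounds for 2-regular graphs

record Cyclic {n : ℕ} (G : Graph n) : Set where
  field
    orientation : Orientation G
    cycles      : List (List (Fin n))
  open Orientation orientation public
  field
    long  : All (λ c → 3 ≤ length c) cycles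
    size  : total cycles ≡ n
    arc   : ∀ u → (u , σ u) ∈ allArcs cycles
    arc⁻¹ : ∀ {u v} → (u , v) ∈ allArcs cycles → v ≡ σ u

cyclic : ∀ {n} (G : Graph n) → Regular 2 G → Cyclic G
cyclic {n} G regular = record
  { orientation = record
    { σ         = σ
    ; out       = λ u → edges (arc u)
    ; split     = λ uv → Sum.map arc⁻¹ arc⁻¹ (saturated Z (all∈ _) uv)
    ; asym      = λ u eq → asym (arc u) (subst (λ v → (σ u , v) ∈ allArcs cs) eq (arc (σ u)))
    ; injective = λ {u} {v} eq → predecessor-unique Z (arc u)
        (subst (λ w → (v , w) ∈ allArcs cs) (≡-sym eq) (arc v))
    }
  ; cycles = cs
  ; long   = long
  ; size   = trans (≡-sym (length-concat cs)) (ℕₚ.≤-antisym (Unique-length unique) (complete-length all∈))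
  ; arc    = arc
  ; arc⁻¹  = arc⁻¹
  }
  where
  E : Fin n → Fin n → Set
  E u v = adj G u v ≡ true
  E-sym : ∀ {u v} → E u v → E v u
  E-sym {u} {v} uv = trans (Graph.sym G v u) uv
  E-irrefl : ∀ {u} → ¬ E u u
  E-irrefl {u} uu = contradiction (trans (≡-sym uu) (irrefl G u)) λ ()
  other : ∀ {u p} → E u p → ∃ λ q → q ≢ p × E u q × (∀ {w} → E u w → w ≡ p ⊎ w ≡ q)
  other {u} {p} u~p = let q , q≢p , uq , only = count≡2 (adj G u) (Uniqueₚ.allFin⁺ n) (regular u) (∈-allFin p) u~p
    in q , q≢p , uq , λ {w} → only (∈-allFin w)
  open Tracing E E-sym E-irrefl other
    (λ u → count>0 (adj G u) (allFin n) (subst (0 <_) (≡-sym (regular u)) (s≤s z≤n)))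
  cs : List (List (Fin n))
  cs = proj₁ decompose
  Z : Cycles cs
  Z = proj₁ (proj₂ decompose)
  open Cycles Z
  all∈ : ∀ v → v ∈ concat cs
  all∈ = proj₂ (proj₂ decompose)
  σ : Fin n → Fin n
  σ u = proj₁ (successor cs (all∈ u))
  arc : ∀ u → (u , σ u) ∈ allArcs cs
  arc u = proj₂ (successor cs (all∈ u))
  arc⁻¹ : ∀ {u v} → (u , v) ∈ allArcs cs → v ≡ σ u
  arc⁻¹ {u} uv = functional (subst Unique (≡-sym (firsts-allArcs cs)) unique) uv (arc u)

module _ {n : ℕ} {G : Graph n} (K : Cyclic G) where
  open Cyclic K

  arranged⇒HasSpread : ∀ {s xs} → length xs ≡ total cycles → Arranged s xs cycles → HasSpread G s
  arranged⇒HasSpread {xs = xs} len arr = spaced⇒HasSpread orientation xs (trans len size)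
    λ u → All.lookup (Allₚ.concat⁺ (Allₚ.map⁺ arr)) (arc u)

  spread-third : ∃ λ s → n < 3 * suc s × HasSpread G s
  spread-third = let s , xs , n< , len , arr = arrange long
    in s , subst (_< 3 * suc s) size n< , arranged⇒HasSpread len arr

  -- With two colours that change at every arc, a walk has an even number of arcs exactly when its
  -- ends have the same colour, and the ends of a closed walk coincide.
  alternating-even : (g : Fin n → Fin 2) → (∀ u → g u ≢ g (σ u)) → All (λ c → 2 ∣ length c) cycles
  alternating-even g alt = All.tabulate λ {c} c∈ → even c (All.tabulate λ xy∈ →
    subst (λ v → _ ≢ g v) (≡-sym (arc⁻¹ (∈-concat⁺′ xy∈ (∈-map⁺ arcs c∈)))) (alt _))
    where
    two-colours : ∀ {a b c : Fin 2} → a ≢ b → b ≢ c → a ≡ c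
    two-colours {zero}     {zero}     a≢b b≢c = contradiction refl a≢b
    two-colours {zero}     {suc zero} {zero} a≢b b≢c = refl
    two-colours {zero}     {suc zero} {suc zero} a≢b b≢c = contradiction refl b≢c
    two-colours {suc zero} {suc zero} a≢b b≢c = contradiction refl a≢b
    two-colours {suc zero} {zero} {suc zero} a≢b b≢c = refl
    two-colours {suc zero} {zero} {zero} a≢b b≢c = contradiction refl b≢c
    Alt : Fin n × Fin n → Set
    Alt (u , v) = g u ≢ g v
    walk : ∀ x xs z → All Alt (links (x ∷ xs ∷ʳ z)) →
      (g x ≡ g z × 2 ∣ suc (length xs)) ⊎ (g x ≢ g z × 2 ∣ length xs)
    walk x []       z (x≢z ∷ []) = inj₂ (x≢z , 2 ∣0)
    walk x (y ∷ xs) z (x≢y ∷ as) with walk y xs z as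
    ... | inj₁ (y≡z , even) = inj₂ (x≢y ∘ (λ x≡z → trans x≡z (≡-sym y≡z)) , even)
    ... | inj₂ (y≢z , even) = inj₁ (two-colours x≢y y≢z , ∣m∣n⇒∣m+n ∣-refl even)
    even : ∀ c → All Alt (arcs c) → 2 ∣ length c
    even []       _  = 2 ∣0
    even (x ∷ xs) as with walk x xs x as
    ... | inj₁ (_ , even) = even
    ... | inj₂ (x≢x , _)  = contradiction refl x≢x

  -- The colour of an edge is given to its tail; then properness says that `u` and `σ u` have
  -- different colours.
  spread-half : Class1 2 G → ∃ λ s → n ≤ suc s * 2 × HasSpread G s
  spread-half (colour , proper) =
    let s , xs , n≤ , len , arr = arrangeEven long (alternating-even (colour ∘ proj₁ ∘ edgeAt) alt)
    in s , subst (_≤ suc s * 2) size n≤ , arranged⇒HasSpread len arr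
    where
    open Tails orientation
    alt : ∀ u → colour (proj₁ (edgeAt u)) ≢ colour (proj₁ (edgeAt (σ u)))
    alt u = proper _ _ (consecutive⇒adjacent {proj₁ (edgeAt u)} {proj₁ (edgeAt (σ u))}
      (trans (proj₂ (edgeAt (σ u))) (cong σ (≡-sym (proj₂ (edgeAt u))))))

-- Upper bounds for the spread

module _ {m t : ℕ} where

  dist-flip : ∀ (a b : Fin m) → t ≤ dist a b → t ≤ dist b a
  dist-flip a b = subst (t ≤_) (dist-comm a b)

  -- The gaps from `a` to `b`, from `b` to `c` and from `c` across the end of the circle back to `a`
  -- add up to `m`.
  sorted-triple : ∀ {a b c : Fin m} → toℕ a < toℕ b → toℕ b < toℕ c →
    t ≤ dist a b → t ≤ dist b c → t ≤ dist a c → t * 3 ≤ m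
  sorted-triple {a} {b} {c} a<b b<c ab bc ac = ℕₚ.+-cancelʳ-≤ (toℕ a) (t * 3) m (begin
    t * 3 + toℕ a       ≡⟨ spread-out t (toℕ a) ⟩
    t + (t + toℕ a) + t ≤⟨ ℕₚ.+-monoˡ-≤ t (ℕₚ.+-monoʳ-≤ t (proj₁ (dist-elim {a = a} {b} a<b ab))) ⟩
    t + toℕ b + t       ≤⟨ ℕₚ.+-monoˡ-≤ t (proj₁ (dist-elim {a = b} {c} b<c bc)) ⟩
    toℕ c + t           ≤⟨ proj₂ (dist-elim {a = a} {c} (ℕₚ.<-trans a<b b<c) ac) ⟩
    m + toℕ a           ∎)
    where
    open ℕₚ.≤-Reasoning
    spread-out : ∀ t a → t * 3 + a ≡ t + (t + a) + t
    spread-out = solve-∀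

  triple : ∀ {a b c : Fin m} → a ≢ b → b ≢ c → a ≢ c →
    t ≤ dist a b → t ≤ dist b c → t ≤ dist a c → t * 3 ≤ m
  triple {a} {b} {c} a≢b b≢c a≢c ab bc ac with Finₚ.<-cmp a b | Finₚ.<-cmp b c | Finₚ.<-cmp a c
  ... | tri≈ _ eq _ | _           | _           = contradiction eq a≢b
  ... | _           | tri≈ _ eq _ | _           = contradiction eq b≢c
  ... | _           | _           | tri≈ _ eq _ = contradiction eq a≢c
  ... | tri< lt _ _ | tri< lt′ _ _ | _ = sorted-triple {a} {b} {c} lt lt′ ab bc ac
  ... | tri< lt _ _ | tri> _ _ gt′ | tri< lt″ _ _ = sorted-triple {a} {c} {b} lt″ gt′ ac (dist-flip b c bc) ab
  ... | tri< lt _ _ | tri> _ _ gt′ | tri> _ _ gt″ = sorted-triple {c} {a} {b} gt″ lt (dist-flip a c ac) ab (dist-flip b c bc)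
  ... | tri> _ _ gt | tri< lt′ _ _ | tri< lt″ _ _ = sorted-triple {b} {a} {c} gt lt″ (dist-flip a b ab) ac bc
  ... | tri> _ _ gt | tri< lt′ _ _ | tri> _ _ gt″ = sorted-triple {b} {c} {a} lt′ gt″ bc (dist-flip a c ac) (dist-flip a b ab)
  ... | tri> _ _ gt | tri> _ _ gt′ | _ = sorted-triple {c} {b} {a} gt′ gt (dist-flip b c bc) (dist-flip a b ab) (dist-flip a c ac)

  -- The two ways around the circle are each at least `t` and have sum `m`, which is at most
  -- `t * 2`; so both are exactly `t`.
  ahead-half : ∀ {a b : Fin m} → m ≤ t * 2 → toℕ a < toℕ b → t ≤ dist a b → toℕ b ≡ t + toℕ a
  ahead-half {a} {b} m≤ lt ab = let far , back = dist-elim {a = a} {b} lt ab in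
    ℕₚ.≤-antisym (ℕₚ.+-cancelʳ-≤ t _ _ (begin
      toℕ b + t     ≤⟨ back ⟩
      m + toℕ a     ≤⟨ ℕₚ.+-monoˡ-≤ (toℕ a) m≤ ⟩
      t * 2 + toℕ a ≡⟨ halves t (toℕ a) ⟩
      t + toℕ a + t ∎)) far
    where
    open ℕₚ.≤-Reasoning
    halves : ∀ t a → t * 2 + a ≡ t + a + t
    halves = solve-∀

  half-turn : ∀ {a b : Fin m} → m ≤ t * 2 → a ≢ b → t ≤ dist a b →
    toℕ b ≡ t + toℕ a ⊎ toℕ a ≡ t + toℕ b
  half-turn {a} {b} m≤ a≢b ab with Finₚ.<-cmp a b
  ... | tri< lt _ _ = inj₁ (ahead-half {a} {b} m≤ lt ab)
  ... | tri≈ _ eq _ = contradiction eq a≢b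
  ... | tri> _ _ gt = inj₂ (ahead-half {b} {a} m≤ gt (dist-flip a b ab))

  -- If `m` were at most `t * 2`, both `b` and `c` would be the antipode of `a`.
  antipode-unique : ∀ {a b c : Fin m} → a ≢ b → a ≢ c → b ≢ c → t ≤ dist a b → t ≤ dist a c → t * 2 < m
  antipode-unique {a} {b} {c} a≢b a≢c b≢c ab ac = ℕₚ.≰⇒> λ m≤ → clash m≤ (half-turn {a} {b} m≤ a≢b ab) (half-turn {a} {c} m≤ a≢c ac)
    where
    -- Two steps of `t` upwards from `b` end at `t * 2` or more, beyond the last position `m - 1`.
    wrap-around : m ≤ t * 2 → ∀ (b c : Fin m) → toℕ a ≡ t + toℕ b → toℕ c ≡ t + toℕ a → ⊥
    wrap-around m≤ b c p q = ℕₚ.<⇒≱ (Finₚ.toℕ<n c) (begin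
      m               ≤⟨ m≤ ⟩
      t * 2           ≡⟨ double t ⟩
      t + t           ≤⟨ ℕₚ.+-monoʳ-≤ t (ℕₚ.m≤m+n t (toℕ b)) ⟩
      t + (t + toℕ b) ≡⟨ cong (t +_) (≡-sym p) ⟩
      t + toℕ a       ≡⟨ ≡-sym q ⟩
      toℕ c           ∎)
      where
      open ℕₚ.≤-Reasoning
      double : ∀ t → t * 2 ≡ t + t
      double = solve-∀
    clash : m ≤ t * 2 → toℕ b ≡ t + toℕ a ⊎ toℕ a ≡ t + toℕ b → toℕ c ≡ t + toℕ a ⊎ toℕ a ≡ t + toℕ c → ⊥
    clash m≤ (inj₁ p) (inj₁ q) = b≢c (Finₚ.toℕ-injective (trans p (≡-sym q)))
    clash m≤ (inj₁ p) (inj₂ q) = wrap-around m≤ c b q p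
    clash m≤ (inj₂ p) (inj₁ q) = wrap-around m≤ b c p q
    clash m≤ (inj₂ p) (inj₂ q) = b≢c (Finₚ.toℕ-injective (ℕₚ.+-cancelˡ-≡ t _ _ (trans (≡-sym p) q)))

module _ {n : ℕ} {G : Graph n} (O : Orientation G) where
  open Orientation O
  open Tails O

  private
    module _ {m t : ℕ} (ℓ : Ordering G m) (spread : Spread {G = G} ℓ t) where

      at : Fin n → Fin m
      at u = Bijection.to ℓ (proj₁ (edgeAt u))

      at-injective : ∀ {u v} → at u ≡ at v → u ≡ v
      at-injective {u} {v} eq = trans (≡-sym (proj₂ (edgeAt u)))
        (trans (cong tail (Bijection.injective ℓ eq)) (proj₂ (edgeAt v)))

      step-spread : ∀ u → t ≤ dist (at u) (at (σ u))
      step-spread u = spread _ _ (consecutive⇒adjacent {proj₁ (edgeAt u)} {proj₁ (edgeAt (σ u))}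
        (trans (proj₂ (edgeAt (σ u))) (cong σ (≡-sym (proj₂ (edgeAt u))))))

  triangle-bound : ∀ {u} → σ (σ (σ u)) ≡ u → ∀ {m} (ℓ : Ordering G m) t → Spread {G = G} ℓ t → t ≤ n / 3
  triangle-bound {u} eq {m} ℓ t spread = begin
    t         ≡⟨ ≡-sym (DivMod.m*n/n≡m t 3) ⟩
    t * 3 / 3 ≤⟨ DivMod./-monoˡ-≤ 3 (triple {a = p u} {p (σ u)} {p (σ (σ u))}
                   (fixfree u ∘ ≡-sym ∘ inj) (fixfree (σ u) ∘ ≡-sym ∘ inj) (asym u ∘ ≡-sym ∘ inj)
                   (near u) (near (σ u))
                   (subst (t ≤_) (dist-comm (p (σ (σ u))) (p u))
                     (subst (λ v → t ≤ dist (p (σ (σ u))) (p v)) eq (near (σ (σ u)))))) ⟩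
    m / 3     ≡⟨ cong (_/ 3) (ordering-size ℓ) ⟩
    n / 3     ∎
    where
    open ℕₚ.≤-Reasoning
    p = at ℓ spread
    inj = at-injective ℓ spread
    near = step-spread ℓ spread

  -- The edge with tail `σ u` is adjacent to the edges with tails `u` and `σ (σ u)`, which are
  -- distinct by `asym`; they cannot both be antipodal to it.
  half-bound : Fin n → ∀ {m} (ℓ : Ordering G m) t → Spread {G = G} ℓ t → t * 2 < n
  half-bound u {m} ℓ t spread = subst (t * 2 <_) (ordering-size ℓ)
    (antipode-unique {a = p (σ u)} {p u} {p (σ (σ u))}
      (fixfree u ∘ inj) (fixfree (σ u) ∘ ≡-sym ∘ inj) (asym u ∘ ≡-sym ∘ inj)
      (subst (t ≤_) (dist-comm (p u) (p (σ u))) (near u)) (near (σ u)))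
    where
    p = at ℓ spread
    inj = at-injective ℓ spread
    near = step-spread ℓ spread

-- Extremal graphs

-- The graph of the cycles of a permutation. By `asym` there are no cycles of length 1 or 2, which
-- makes the graph loopless and gives each vertex two distinct neighbours.
module Permutation {n : ℕ} (σ σ⁻¹ : Fin n → Fin n) (leftInv : ∀ u → σ⁻¹ (σ u) ≡ u)
  (rightInv : ∀ u → σ (σ⁻¹ u) ≡ u) (asym : ∀ u → σ (σ u) ≢ u) where

  adjᵇ : Fin n → Fin n → Bool
  adjᵇ u v = ⌊ v Fin.≟ σ u ⌋ ∨ ⌊ u Fin.≟ σ v ⌋

  adjᵇ-split : ∀ {u v} → adjᵇ u v ≡ true → v ≡ σ u ⊎ u ≡ σ v
  adjᵇ-split {u} {v} eq with v Fin.≟ σ u | u Fin.≟ σ v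
  ... | yes p | _     = inj₁ p
  ... | no _  | yes q = inj₂ q
  adjᵇ-split {u} {v} () | no _ | no _

  adjᵇ-out : ∀ u → adjᵇ u (σ u) ≡ true
  adjᵇ-out u with σ u Fin.≟ σ u
  ... | yes _ = refl
  ... | no ≢  = contradiction refl ≢

  graph : Graph n
  graph = record
    { adj    = adjᵇ
    ; sym    = λ u v → Boolₚ.∨-comm ⌊ v Fin.≟ σ u ⌋ ⌊ u Fin.≟ σ v ⌋
    ; irrefl = λ u → Boolₚ.¬-not λ eq → Sum.[ loop u , loop u ] (adjᵇ-split {u} {u} eq)
    }
    where
    loop : ∀ u → u ≢ σ u
    loop u eq = asym u (trans (cong σ (≡-sym eq)) (≡-sym eq))

  orientation : Orientation graph
  orientation = record
    { σ         = σ
    ; out       = adjᵇ-out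
    ; split     = adjᵇ-split
    ; asym      = asym
    ; injective = λ {u} {v} eq → trans (≡-sym (leftInv u)) (trans (cong σ⁻¹ eq) (leftInv v))
    }

  regular : Regular 2 graph
  regular u = two⇒count≡2 (adjᵇ u) (Uniqueₚ.allFin⁺ n) (∈-allFin (σ u)) (∈-allFin (σ⁻¹ u))
    (λ eq → asym u (trans (cong σ eq) (rightInv u)))
    (adjᵇ-out u)
    (trans (Graph.sym graph u (σ⁻¹ u)) (subst (λ v → adjᵇ (σ⁻¹ u) v ≡ true) (rightInv u) (adjᵇ-out (σ⁻¹ u))))
    λ {v} _ uv → Sum.map₂ (λ eq → trans (≡-sym (leftInv v)) (cong σ⁻¹ (≡-sym eq))) (adjᵇ-split uv)

module _ {m : ℕ} where

  -- The successor modulo `suc m`; its graph is a single cycle.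
  rot : Fin (suc m) → Fin (suc m)
  rot i with view i
  ... | ‵fromℕ         = zero
  ... | ‵inj₁ {i = j} _ = suc j

  rot⁻¹ : Fin (suc m) → Fin (suc m)
  rot⁻¹ zero    = fromℕ m
  rot⁻¹ (suc j) = inject₁ j

  rot⁻¹∘rot : ∀ i → rot⁻¹ (rot i) ≡ i
  rot⁻¹∘rot i with view i
  ... | ‵fromℕ  = refl
  ... | ‵inj₁ _ = refl

  rot∘rot⁻¹ : ∀ i → rot (rot⁻¹ i) ≡ i
  rot∘rot⁻¹ zero    rewrite view-fromℕ m   = refl
  rot∘rot⁻¹ (suc j) rewrite view-inject₁ j = refl

  toℕ-rot : ∀ i → toℕ (rot i) ≡ suc (toℕ i) ⊎ (toℕ (rot i) ≡ 0 × toℕ i ≡ m)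
  toℕ-rot i with view i
  ... | ‵fromℕ          = inj₂ (refl , Finₚ.toℕ-fromℕ m)
  ... | ‵inj₁ {i = j} _ = inj₁ (cong suc (≡-sym (Finₚ.toℕ-inject₁ j)))

  rot-asym : 2 ≤ m → ∀ i → rot (rot i) ≢ i
  rot-asym 2≤m i eq with toℕ-rot i | toℕ-rot (rot i)
  ... | inj₁ p        | inj₁ q        = ℕₚ.m≢1+n+m (toℕ i) {1} (trans (≡-sym (cong toℕ eq)) (trans q (cong suc p)))
  ... | inj₁ p        | inj₂ (q , r)  = ℕₚ.<⇒≢ 2≤m (trans (cong suc (trans (≡-sym q) (cong toℕ eq))) (trans (≡-sym p) r))
  ... | inj₂ (p , r)  | inj₁ q        = ℕₚ.<⇒≢ 2≤m (trans (≡-sym (trans q (cong suc p))) (trans (cong toℕ eq) r))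
  ... | inj₂ (p , r)  | inj₂ (_ , r′) = ℕₚ.<⇒≢ (ℕₚ.<-trans (s≤s z≤n) 2≤m) (trans (≡-sym p) r′)

module _ {m : ℕ} where

  -- A triangle beside one cycle through the remaining `suc m` vertices. The second cycle needs at
  -- least 3 vertices, which is where `6 ≤ n` enters.
  turn turn⁻¹ : Fin (3 + suc m) → Fin (3 + suc m)
  turn zero                = suc zero
  turn (suc zero)          = suc (suc zero)
  turn (suc (suc zero))    = zero
  turn (suc (suc (suc i))) = suc (suc (suc (rot i)))
  turn⁻¹ zero                = suc (suc zero)
  turn⁻¹ (suc zero)          = zero
  turn⁻¹ (suc (suc zero))    = suc zero
  turn⁻¹ (suc (suc (suc i))) = suc (suc (suc (rot⁻¹ i)))

  turn⁻¹∘turn : ∀ i → turn⁻¹ (turn i) ≡ i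
  turn⁻¹∘turn zero                = refl
  turn⁻¹∘turn (suc zero)          = refl
  turn⁻¹∘turn (suc (suc zero))    = refl
  turn⁻¹∘turn (suc (suc (suc i))) = cong (λ j → suc (suc (suc j))) (rot⁻¹∘rot i)

  turn∘turn⁻¹ : ∀ i → turn (turn⁻¹ i) ≡ i
  turn∘turn⁻¹ zero                = refl
  turn∘turn⁻¹ (suc zero)          = refl
  turn∘turn⁻¹ (suc (suc zero))    = refl
  turn∘turn⁻¹ (suc (suc (suc i))) = cong (λ j → suc (suc (suc j))) (rot∘rot⁻¹ i)

  turn-asym : 2 ≤ m → ∀ i → turn (turn i) ≢ i
  turn-asym 2≤m zero                ()
  turn-asym 2≤m (suc zero)          ()
  turn-asym 2≤m (suc (suc zero))    ()
  turn-asym 2≤m (suc (suc (suc i))) eq =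
    rot-asym 2≤m i (Finₚ.suc-injective (Finₚ.suc-injective (Finₚ.suc-injective eq)))

-- The two minima

third-≤ : ∀ {n s} → n < 3 * suc s → n / 3 ≤ s
third-≤ {n} {s} n< = s≤s⁻¹ (DivMod.m<n*o⇒m/o<n {n} {suc s} {3} (subst (n <_) (ℕₚ.*-comm 3 (suc s)) n<))

hasThird : ∀ {n} (G : Graph n) → Regular 2 G → HasSpread G (n / 3)
hasThird G regular = let s , n< , m , ℓ , spread = spread-third (cyclic G regular)
  in m , ℓ , Spread-≤ {G = G} {ℓ} (third-≤ n<) spread

hasHalf : ∀ {n} (G : Graph n) → Regular 2 G → Class1 2 G → HasSpread G ((n ∸ 2) / 2)
hasHalf {n} G regular class1 = let s , n≤ , m , ℓ , spread = spread-half (cyclic G regular) class1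
  in m , ℓ , Spread-≤ {G = G} {ℓ} (half-≤ s n≤) spread
  where
  half-≤ : ∀ s → n ≤ suc s * 2 → (n ∸ 2) / 2 ≤ s
  half-≤ s n≤ = subst ((n ∸ 2) / 2 ≤_) (DivMod.m*n/n≡m s 2) (DivMod./-monoˡ-≤ 2 (ℕₚ.∸-monoˡ-≤ 2 n≤))

parity : ℕ → Fin 2
parity zero          = zero
parity (suc zero)    = suc zero
parity (suc (suc n)) = parity n

parity-suc : ∀ n → parity (suc n) ≢ parity n
parity-suc zero          ()
parity-suc (suc zero)    ()
parity-suc (suc (suc n)) = parity-suc n

parity-odd : ∀ k → parity (suc (k * 2)) ≡ suc zero
parity-odd zero    = refl
parity-odd (suc k) = parity-odd k

theorem1p2 : (∀ (n : ℕ) → 6 ≤ n → IsCms n 2 (n / 3)) ×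
    (∀ (n : ℕ) → 4 ≤ n → 2 ∣ n → IsCms₁ n 2 ((n ∸ 2) / 2))
theorem1p2 = third , half
  where
  third : ∀ n → 6 ≤ n → IsCms n 2 (n / 3)
  third n@(suc (suc (suc (suc m)))) 6≤n@(s≤s (s≤s (s≤s (s≤s 2≤m)))) =
    -- Vertex `zero` lies on the triangle, so three applications of `turn` return to it by
    -- computation.
    (graph , regular , cms-≡ orientation 1≤ ≤n (hasThird graph regular) (triangle-bound orientation {u = zero} refl)) ,
    λ G t reg → cms-≥ (Cyclic.orientation (cyclic G reg)) 1≤ ≤n (hasThird G reg)
    where
    open Permutation (turn {m}) turn⁻¹ turn⁻¹∘turn turn∘turn⁻¹ (turn-asym 2≤m)
    1≤ : 1 ≤ n / 3
    1≤ = ℕₚ.≤-trans (s≤s z≤n) (DivMod./-monoˡ-≤ 3 6≤n)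
    ≤n : n / 3 ≤ n
    ≤n = DivMod.m/n≤m n 3

  half : ∀ n → 4 ≤ n → 2 ∣ n → IsCms₁ n 2 ((n ∸ 2) / 2)
  half n@(suc m) 4≤n@(s≤s 3≤m) (divides (suc k) eq) =
    (graph , (regular , class1) , cms-≡ orientation 1≤ ≤n (hasHalf graph regular class1)
      λ ℓ t spread → bound t (half-bound orientation zero ℓ t spread)) ,
    λ G t (reg , cl) → cms-≥ (Cyclic.orientation (cyclic G reg)) 1≤ ≤n (hasHalf G reg cl)
    where
    open Permutation (rot {m}) rot⁻¹ rot⁻¹∘rot rot∘rot⁻¹ (rot-asym (ℕₚ.<⇒≤ 3≤m))
    open Tails orientation
    -- The last vertex `m` is odd because `n` is even, so the closing arc to vertex 0 changes parity
    -- as well.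
    m-odd : parity m ≡ suc zero
    m-odd = trans (cong parity (ℕₚ.suc-injective eq)) (parity-odd k)
    flips : ∀ u → parity (toℕ (rot u)) ≢ parity (toℕ u)
    flips u p with toℕ-rot u
    ... | inj₁ q       = parity-suc (toℕ u) (trans (≡-sym (cong parity q)) p)
    ... | inj₂ (q , r) = contradiction (trans (trans (≡-sym (cong parity q)) p) (trans (cong parity r) m-odd)) λ ()
    colour : Edge graph → Fin 2
    colour e = parity (toℕ (tail e))
    class1 : Class1 2 graph
    class1 = colour , λ e e′ a same → Sum.[
      (λ c → flips (tail e) (trans (cong (parity ∘ toℕ) (≡-sym c)) (≡-sym same))) ,
      (λ c → flips (tail e′) (trans (cong (parity ∘ toℕ) (≡-sym c)) same)) ]
      (adjacent⇒consecutive {e} {e′} a)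
    1≤ : 1 ≤ (n ∸ 2) / 2
    1≤ = DivMod./-monoˡ-≤ 2 (ℕₚ.∸-monoˡ-≤ 2 4≤n)
    ≤n : (n ∸ 2) / 2 ≤ n
    ≤n = ℕₚ.≤-trans (DivMod.m/n≤m (n ∸ 2) 2) (ℕₚ.m∸n≤m n 2)
    -- For `n = suc k * 2` the strict inequality gives `t ≤ k`, and `k` is `(n ∸ 2) / 2`.
    bound : ∀ t → t * 2 < n → t ≤ (n ∸ 2) / 2
    bound t t< = begin
      t                      ≤⟨ s≤s⁻¹ (ℕₚ.*-cancelʳ-< 2 t (suc k) (subst (t * 2 <_) eq t<)) ⟩
      k                      ≡⟨ ≡-sym (DivMod.m*n/n≡m k 2) ⟩
      (suc k * 2 ∸ 2) / 2    ≡⟨ cong (λ n → (n ∸ 2) / 2) (≡-sym eq) ⟩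
      (n ∸ 2) / 2            ∎
      where open ℕₚ.≤-Reasoning
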